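{- Let $S$ be a finite set of non-zero integers and let $d$ be a positive integer. Then for $i=0,1,2$, $$|\mathbf{D}_i(S)|=\frac{2^{|S|}\varphi(d)}{|\mathcal{D}_i|}.$$
   Context: For a non-zero integer $n$, $\mathrm{sqf}(n)$ is its squarefree part: the unique squarefree integer $s$ (of the same sign as $n$) with $n=sm^2$ for some integer $m$. For a finite set $T$ of non-zero integers, $\mathrm{sqf}(T)=\mathrm{sqf}\left(\prod_{s\in T}s\right)$, and $\mathrm{sqf}(\emptyset)=1$. Define sets of subsets of $S$: $\mathcal{D}_0=\{T\subseteq S:\mathrm{sqf}(T)\mid d\}$, $\mathcal{D}_1=\{T\in\mathcal{D}_0:\mathrm{sqf}(T)\equiv 1\text{ or }3\ (\mathrm{mod}\ 4)\}$, $\mathcal{D}_2=\{T\in\mathcal{D}_0:\mathrm{sqf}(T)\equiv 1\ (\mathrm{mod}\ 4)\}$. $\mathbf{F}(S)$ is the group, under pointwise multiplication, of all maps $\theta:S\to\{ -1,1\}$; for $T\subseteq S$, $\theta(T)=\prod_{s\in T}\theta(s)$, with $\theta(\emptyset)=1$. $\mathbb{Z}_d^*$ is the group of units modulo $d$, its elements represented by integers $1\le f\le d$ with $(f,d)=1$; it has order $\varphi(d)$. For a positive integer $f$, $\left(\frac{\cdot}{f}\right)$ is the Jacobi symbol (Kronecker symbol if $f$ is even). For $i=0,1,2$, $$\mathbf{D}_i(S)=\left\{(f,\theta)\in\mathbb{Z}_d^*\times\mathbf{F}(S):\theta(T)\left(\frac{\mathrm{sqf}(T)}{f}\right)=1\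 \text{for all } T\in\mathcal{D}_i\right\},$$ where $f$ in the symbol denotes the chosen representative. -}

module Defs where

open import Algebra.Bundles.Raw using (RawMonoid)
open import Data.Bool.Base using (if_then_else_)
open import Data.Fin.Base using (Fin; toℕ)
open import Data.Fin.Patterns using (0F; 1F; 2F)
open import Data.Fin.Properties using (any?)
open import Data.Fin.Subset using (Subset; inside; outside; ⊥)
open import Data.Integer.Base as ℤ using (ℤ; +_; 0ℤ; 1ℤ; -1ℤ; ∣_∣; sign; _◃_; _*_; _-_; _%ℕ_)
open import Data.Integer.Divisibility using (_∣_)
import Data.Integer.Properties as ℤ
open import Data.List.Base as List
  using (List; []; _∷_; cartesianProduct; cartesianProductWith; filter; foldr; length; upTo)
open import Data.List.Membership.Propositional using (_∈_)
open import Data.List.Membership.Propositional.Properties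
  using (∈-filter⁺; ∈-cartesianProductWith⁺; ∈-length)
open import Data.List.Relation.Unary.All as ListAll using ()
open import Data.List.Relation.Unary.Any using (here; there)
open import Data.Nat.Base as ℕ using (ℕ; zero; suc; NonZero; _≡ᵇ_)
open import Data.Nat.Coprimality using (coprime?)
import Data.Nat.Divisibility as ℕ
open import Data.Nat.Primality.Factorisation using (factorise; factors)
import Data.Nat.Properties as ℕ
open import Data.Nat.Solver using (module +-*-Solver)
open import Data.Product.Base using (∃; _×_; _,_; proj₁; proj₂)
open import Data.Sign.Base as Sign using (Sign)
import Data.Sign.Properties as Sign
open import Data.Sum.Base using (_⊎_; inj₁; inj₂)
open import Data.Unit.Base using (⊤; tt)
open import Data.Vec.Base as Vec using (Vec)
open import Data.Vec.Relation.Unary.All using (All; []; _∷_)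
open import Level using (0ℓ)
open import Relation.Binary.PropositionalEquality
open import Relation.Nullary.Decidable using (Dec; yes; no; does; map′; _×-dec_; _→-dec_; _⊎-dec_)
open import Relation.Nullary.Negation using (¬_; contradiction)
open import Relation.Unary using (Pred; Decidable)

private
  variable
    A : Set
    n : ℕ

infix 4 _∣?_
_∣?_ : ∀ a b → Dec (a ∣ b)
a ∣? b = ∣ a ∣ ℕ.∣? ∣ b ∣

Squarefree : ℤ → Set
Squarefree s = ∀ m → m * m ∣ s → ∣ m ∣ ≡ 1

record IsSquarefreePart (n s : ℤ) : Set where
  field
    squarefree : Squarefree s
    sameSign   : sign s ≡ sign n
    square     : ∃ λ m → n ≡ s * (m * m)

private
  largestSquare : ∀ n k → (∀ j → j ℕ.* j ℕ.∣ n → j ℕ.≤ k) →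
                  ∃ λ m → m ℕ.* m ℕ.∣ n × (∀ j → j ℕ.* j ℕ.∣ n → j ℕ.≤ m)
  largestSquare n zero bound = contradiction (bound 1 (ℕ.1∣ n)) λ ()
  largestSquare n (suc k) bound with suc k ℕ.* suc k ℕ.∣? n
  ... | yes k²∣n = suc k , k²∣n , bound
  ... | no  k²∤n = largestSquare n k λ j j²∣n →
    ℕ.s≤s⁻¹ (ℕ.≤∧≢⇒< (bound j j²∣n) λ { refl → k²∤n j²∣n })

  squarefreeQuotient : ∀ n .{{_ : NonZero n}} → ∃ λ s → ∃ λ m →
                       (∀ k → k ℕ.* k ℕ.∣ s → k ≡ 1) × n ≡ s ℕ.* (m ℕ.* m)
  squarefreeQuotient n with largestSquare n n below
    where
    below : ∀ j → j ℕ.* j ℕ.∣ n → j ℕ.≤ n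
    below j j²∣n = ℕ.∣⇒≤ (ℕ.∣-trans (ℕ.m∣m*n j) j²∣n)
  ... | m , ℕ.divides s n≡sm² , largest = s , m , sqfree , n≡sm²
    where
    n≢0 : ¬ n ≡ 0
    n≢0 = ℕ.≢-nonZero⁻¹ n

    m≢0 : NonZero m
    m≢0 = ℕ.≢-nonZero λ { refl → n≢0 (trans n≡sm² (ℕ.*-zeroʳ s)) }

    rearrange : ∀ q k m → q ℕ.* (k ℕ.* k) ℕ.* (m ℕ.* m) ≡ q ℕ.* ((k ℕ.* m) ℕ.* (k ℕ.* m))
    rearrange = solve 3 (λ q k m → q :* (k :* k) :* (m :* m) := q :* ((k :* m) :* (k :* m))) refl
      where open +-*-Solver

    sqfree : ∀ k → k ℕ.* k ℕ.∣ s → k ≡ 1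
    sqfree zero 0∣s = contradiction (trans n≡sm² (cong (ℕ._* (m ℕ.* m)) (ℕ.0∣⇒≡0 0∣s))) n≢0
    sqfree k@(suc _) (ℕ.divides q s≡qk²) = ℕ.≤-antisym
      (ℕ.*-cancelʳ-≤ k 1 m {{m≢0}} (subst (k ℕ.* m ℕ.≤_) (sym (ℕ.*-identityˡ m))
        (largest (k ℕ.* m) (ℕ.divides q
          (trans n≡sm² (trans (cong (ℕ._* (m ℕ.* m)) s≡qk²) (rearrange q k m)))))))
      (ℕ.s≤s ℕ.z≤n)

squarefreePart : ∀ n .{{_ : ℤ.NonZero n}} → ∃ (IsSquarefreePart n)
squarefreePart n with squarefreeQuotient ∣ n ∣
... | s , m , sqfree , ∣n∣≡sm² = sign n ◃ s , record
  { squarefree = λ k k²∣s → sqfree ∣ k ∣ (subst₂ ℕ._∣_ (ℤ.abs-* k k) (ℤ.abs-◃ (sign n) s) k²∣s)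
  ; sameSign   = ℤ.sign-◃ (sign n) s {{s≢0}}
  ; square     = + m , n≡
  }
  where
  s≢0 : NonZero s
  s≢0 = ℕ.≢-nonZero λ { refl → contradiction (sqfree 0 (0 ℕ.∣0)) λ () }

  n≡ : n ≡ (sign n ◃ s) * (+ m * + m)
  n≡ = begin
    n                                       ≡⟨ ℤ.signᵢ◃∣i∣≡i n ⟨
    sign n ◃ ∣ n ∣                          ≡⟨ cong (sign n ◃_) ∣n∣≡sm² ⟩
    sign n ◃ s ℕ.* (m ℕ.* m)                ≡⟨ cong (_◃ s ℕ.* (m ℕ.* m)) (Sign.*-identityʳ (sign n)) ⟨
    sign n Sign.* Sign.+ ◃ s ℕ.* (m ℕ.* m)  ≡⟨ ℤ.◃-distrib-* (sign n) Sign.+ s (m ℕ.* m) ⟩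
    (sign n ◃ s) * (Sign.+ ◃ m ℕ.* m)       ≡⟨⟩
    (sign n ◃ s) * (+ m * + m)              ∎
    where open ≡-Reasoning

sqf : ∀ n .{{_ : ℤ.NonZero n}} → ℤ
sqf n = proj₁ (squarefreePart n)

IsSquareMod : ℤ → ℕ → Set
IsSquareMod a p = ∃ λ (x : Fin p) → + p ∣ + toℕ x * + toℕ x - a

isSquareMod? : ∀ a p → Dec (IsSquareMod a p)
isSquareMod? a p = any? λ x → + p ∣? + toℕ x * + toℕ x - a

-- Meaningful only when p is an odd prime.
legendre : ℤ → ℕ → ℤ
legendre a p =
  if does (+ p ∣? a) then 0ℤ else
  if does (isSquareMod? a p) then 1ℤ else -1ℤ

kronecker₂ : ℤ → ℤ
kronecker₂ a with a %ℕ 8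
... | 1 = 1ℤ
... | 3 = -1ℤ
... | 5 = -1ℤ
... | 7 = 1ℤ
... | _ = 0ℤ

kroneckerPrime : ℤ → ℕ → ℤ
kroneckerPrime a 2 = kronecker₂ a
kroneckerPrime a p = legendre a p

-- For odd f this is the Jacobi symbol.  The list of prime factors is
-- taken with multiplicity; the value at 0 is the customary one.
kronecker : ℤ → ℕ → ℤ
kronecker a zero      = if ∣ a ∣ ≡ᵇ 1 then 1ℤ else 0ℤ
kronecker a f@(suc _) = foldr _*_ 1ℤ (List.map (kroneckerPrime a) (factors (factorise f)))

vectors : List A → ∀ n → List (Vec A n)
vectors as zero    = Vec.[] ∷ []
vectors as (suc n) = cartesianProductWith Vec._∷_ as (vectors as n)

∈-vectors : ∀ {as : List A} → (∀ a → a ∈ as) → (v : Vec A n) → v ∈ vectors as n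
∈-vectors full Vec.[]       = here refl
∈-vectors full (a Vec.∷ v) = ∈-cartesianProductWith⁺ Vec._∷_ (full a) (∈-vectors full v)

subsets : ∀ n → List (Subset n)
subsets = vectors (outside ∷ inside ∷ [])

∈-subsets : (T : Subset n) → T ∈ subsets n
∈-subsets = ∈-vectors λ { outside → here refl ; inside → there (here refl) }

signMaps : ∀ n → List (Vec Sign n)
signMaps = vectors (Sign.+ ∷ Sign.- ∷ [])

-- Representatives 1 ≤ f ≤ d of the units modulo d.
units : ℕ → List ℕ
units d = filter (λ f → coprime? f d) (List.map suc (upTo d))

φ : ℕ → ℕ
φ d = length (units d)

module _ (M : RawMonoid 0ℓ 0ℓ) where
  open RawMonoid M

  subsetProduct : Vec Carrier n → Subset n → Carrier
  subsetProduct Vec.[]       Vec.[]            = ε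
  subsetProduct (x Vec.∷ xs) (inside  Vec.∷ T) = x ∙ subsetProduct xs T
  subsetProduct (x Vec.∷ xs) (outside Vec.∷ T) = subsetProduct xs T

∏ : Vec ℤ n → Subset n → ℤ
∏ = subsetProduct ℤ.*-1-rawMonoid

∏-nonZero : {S : Vec ℤ n} → All ℤ.NonZero S → ∀ T → ℤ.NonZero (∏ S T)
∏-nonZero []                       Vec.[]            = _
∏-nonZero {S = s Vec.∷ S} (px ∷ pxs) (inside  Vec.∷ T) =
  ℤ.i*j≢0 s (∏ S T) {{px}} {{∏-nonZero pxs T}}
∏-nonZero (px ∷ pxs)               (outside Vec.∷ T) = ∏-nonZero pxs T

∏-⊥ : (S : Vec ℤ n) → ∏ S ⊥ ≡ 1ℤ
∏-⊥ Vec.[]       = refl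
∏-⊥ (s Vec.∷ S) = ∏-⊥ S

-- θ(T) as an integer, for θ a map from the index set of S to {-1,1}.
_⟨_⟩ : Vec Sign n → Subset n → ℤ
θ ⟨ T ⟩ = subsetProduct Sign.*-1-rawMonoid θ T ◃ 1

Congruence : Fin 3 → ℤ → Set
Congruence 0F a = ⊤
Congruence 1F a = a %ℕ 4 ≡ 1 ⊎ a %ℕ 4 ≡ 3
Congruence 2F a = a %ℕ 4 ≡ 1

congruence? : ∀ i → Decidable (Congruence i)
congruence? 0F a = yes tt
congruence? 1F a = (a %ℕ 4 ℕ.≟ 1) ⊎-dec (a %ℕ 4 ℕ.≟ 3)
congruence? 2F a = a %ℕ 4 ℕ.≟ 1

-- A finite set of non-zero integers is given by listing its elements
-- without repetition; the sets T ⊆ S are then the subsets of indices.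
module _ (S : Vec ℤ n) (S≢0 : All ℤ.NonZero S) where

  sqfSet : Subset n → ℤ
  sqfSet T = sqf (∏ S T) {{∏-nonZero S≢0 T}}

  module _ (d : ℕ) (i : Fin 3) where

    𝒟 : Pred (Subset n) 0ℓ
    𝒟 T = sqfSet T ∣ + d × Congruence i (sqfSet T)

    𝒟? : Decidable 𝒟
    𝒟? T = (sqfSet T ∣? + d) ×-dec congruence? i (sqfSet T)

    ∣𝒟∣ : ℕ
    ∣𝒟∣ = length (filter 𝒟? (subsets n))

    -- Membership for pairs (f , θ) whose f is listed in units d.
    𝐃 : Pred (ℕ × Vec Sign n) 0ℓ
    𝐃 (f , θ) = ∀ T → 𝒟 T → θ ⟨ T ⟩ * kronecker (sqfSet T) f ≡ 1ℤ

    𝐃? : Decidable 𝐃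
    𝐃? (f , θ) = map′ (λ all T → ListAll.lookup all (∈-subsets T)) (λ all → ListAll.tabulate λ {T} _ → all T)
      (ListAll.all? (λ T → 𝒟? T →-dec (θ ⟨ T ⟩ * kronecker (sqfSet T) f ℤ.≟ 1ℤ)) (subsets n))

    ∣𝐃∣ : ℕ
    ∣𝐃∣ = length (filter 𝐃? (cartesianProduct (units d) (signMaps n)))

    𝒟-⊥ : 𝒟 ⊥
    𝒟-⊥ = subst (λ s → s ∣ + d × Congruence i s) (sym sqfSet-⊥) (ℕ.1∣ d , congruence-1 i)
      where
      sqf-1 : ∀ {a s} → a ≡ 1ℤ → IsSquarefreePart a s → s ≡ 1ℤ
      sqf-1 {s = s} refl sp = ℤ.◃-cong sameSign
        (ℕ.m*n≡1⇒m≡1 ∣ s ∣ ∣ m * m ∣ (sym (trans (cong ∣_∣ (proj₂ square)) (ℤ.abs-* s (m * m)))))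
        where
        open IsSquarefreePart sp
        m = proj₁ square

      sqfSet-⊥ : sqfSet ⊥ ≡ 1ℤ
      sqfSet-⊥ = sqf-1 (∏-⊥ S) (proj₂ (squarefreePart (∏ S ⊥) {{∏-nonZero S≢0 ⊥}}))

      congruence-1 : ∀ i → Congruence i 1ℤ
      congruence-1 0F = tt
      congruence-1 1F = inj₁ refl
      congruence-1 2F = refl

    ∣𝒟∣-nonZero : NonZero ∣𝒟∣
    ∣𝒟∣-nonZero = ℕ.>-nonZero (∈-length (∈-filter⁺ 𝒟? (∈-subsets ⊥) 𝒟-⊥))

{-# OPTIONS --safe #-}

-- For a unit f modulo d, T ↦ (sqf T / f) is a ±1-valued character of the subgroup 𝒟 of the
-- 𝔽₂-space of subsets of S (under symmetric difference), because
-- sqf T · sqf U = g² · sqf (T ⊕ U) with g prime to f.  Every character of a subgroup W of 𝔽₂ⁿ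
-- has exactly 2ⁿ / ∣W∣ extensions θ to 𝔽₂ⁿ, so each of the φ(d) units contributes 2ⁿ / ∣𝒟∣ pairs.

module Submission where

open import Defs
import Algebra.Properties.CommutativeSemigroup as CommutativeSemigroup
open import Data.Bool.Base using (_xor_)
open import Data.Bool.Properties using (xor-identityˡ; xor-assoc; xor-same)
open import Data.Fin.Base as Fin using (Fin; toℕ; fromℕ<)
open import Data.Fin.Patterns using (0F; 1F; 2F)
import Data.Fin.Properties as Fin
open import Data.Fin.Subset using (Subset; inside; outside; ⊥; _∩_)
open import Data.Fin.Subset.Properties using (anySubset?)
open import Data.Integer.Base as ℤ using (ℤ; +_; 0ℤ; 1ℤ; -1ℤ; ∣_∣; _%ℕ_; _/ℕ_)
import Data.Integer.Coprimality as ℤ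
import Data.Integer.DivMod as ℤ
import Data.Integer.Divisibility as ℤ
open import Data.Integer.Divisibility.Signed as Signed using () renaming (_∣_ to _∣ₛ_)
import Data.Integer.Properties as ℤ
open import Data.Integer.Tactic.RingSolver using (solve-∀)
open import Data.List.Base as List
  using (List; []; _∷_; _++_; cartesianProduct; filter; foldr; length; map; upTo)
open import Data.List.Properties using (filter-++; filter-≐; filter-accept; length-++; ++-identityʳ)
open import Data.List.Relation.Unary.All as ListAll using ([]; _∷_)
import Data.List.Relation.Unary.All.Properties as ListAll
open import Data.Nat.Base as ℕ
  using (ℕ; zero; suc; NonZero; _+_; _*_; _^_; _<_; s≤s; ≢-nonZero⁻¹)
import Data.Nat.Coprimality as ℕ
import Data.Nat.DivMod as ℕ
import Data.Nat.Divisibility as ℕ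
import Data.Nat.GCD as ℕ
open import Data.Nat.ListAction.Properties using (∈⇒∣product)
open import Data.Nat.Primality
  using (Prime; euclidsLemma; prime⇒irreducible; prime⇒nonZero; ¬prime[0]; ¬prime[1])
open import Data.Nat.Primality.Factorisation using (PrimeFactorisation; factorise; factors)
import Data.Nat.Properties as ℕ
open import Data.Nat.Solver using (module +-*-Solver)
open import Data.Product.Base using (∃; ∃₂; _×_; _,_; proj₁; proj₂)
open import Data.Rational.Base using (_/_)
open import Data.Rational.Properties using (fromℚᵘ-cong)
open import Data.Rational.Unnormalised.Base using (mkℚᵘ; *≡*)
open import Data.Sign.Base as Sign using (Sign)
import Data.Sign.Properties as Sign
open import Data.Sum.Base using (_⊎_; inj₁; inj₂; [_,_]′)
open import Data.Unit.Base using (tt)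
open import Data.Vec.Base as Vec using (Vec; zipWith)
open import Data.Vec.Relation.Unary.All using (All)
open import Data.Vec.Relation.Unary.Unique.Propositional using (Unique)
open import Function.Base using (_∘_)
open import Level using (0ℓ)
open import Relation.Binary.PropositionalEquality
open import Relation.Nullary.Decidable using (Dec; yes; no; map′; toWitness; _→-dec_)
open import Relation.Nullary.Negation using (¬_; contradiction)
open import Relation.Unary using (Pred; Decidable)

open CommutativeSemigroup Sign.*-commutativeSemigroup using () renaming (interchange to Sign-interchange)
open CommutativeSemigroup ℤ.*-commutativeSemigroup using () renaming (x∙yz≈y∙xz to x*yz≡y*xz)

-- In each fibre the representative `f` is fixed, so the symbol is studied in its upper argument
-- alone. Its multiplicativity there is derived from the definition through the prime factors of
-- `f`: at 2 it is a finite check modulo 8; at an odd prime the hard case is that two non-squares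
-- have a square product, which is obtained by counting residues. A value 0 would spoil the
-- character. It is excluded on `𝒟` because sqf T divides `d`, which is prime to `f`; this covers
-- even `f` as well, since then `d` and sqf T are odd. The conditions modulo 4 enter in showing that
-- `𝒟` is a subgroup, and from there on the three values of `i` are treated alike. The quotient of
-- 2ⁿ by the order of `𝒟` is carried as an equation between natural numbers, multiplied through by
-- that order, and becomes a fraction at the very end.

private
  variable
    A B : Set
    n : ℕ

-- Extending characters from a subgroup of 𝔽₂ⁿ

count : {P : Pred A 0ℓ} → Decidable P → List A → ℕ
count P? xs = length (filter P? xs)

count-cong : {P Q : Pred A 0ℓ} (P? : Decidable P) (Q? : Decidable Q) → (∀ {x} → P x → Q x) → (∀ {x} → Q x → P x) →
             ∀ xs → count P? xs ≡ count Q? xs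
count-cong P? Q? P⊆Q Q⊆P xs = cong length (filter-≐ P? Q? (P⊆Q , Q⊆P) xs)

count-++ : {P : Pred A 0ℓ} (P? : Decidable P) → ∀ xs ys → count P? (xs ++ ys) ≡ count P? xs + count P? ys
count-++ P? xs ys = trans (cong length (filter-++ P? xs ys)) (length-++ (filter P? xs))

count-map : {P : Pred A 0ℓ} (P? : Decidable P) (f : B → A) → ∀ xs → count P? (map f xs) ≡ count (P? ∘ f) xs
count-map P? f []       = refl
count-map P? f (x ∷ xs) with P? (f x)
... | yes _ = cong suc (count-map P? f xs)
... | no  _ = count-map P? f xs

count-none : {P : Pred A 0ℓ} (P? : Decidable P) → (∀ x → ¬ P x) → ∀ xs → count P? xs ≡ 0
count-none P? ¬P []       = refl
count-none P? ¬P (x ∷ xs) with P? x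
... | yes px = contradiction px (¬P x)
... | no  _  = count-none P? ¬P xs

count-⊎ : {P Q R : Pred A 0ℓ} (P? : Decidable P) (Q? : Decidable Q) (R? : Decidable R) →
          (∀ {x} → P x → R x) → (∀ {x} → Q x → R x) → (∀ {x} → R x → P x ⊎ Q x) →
          (∀ {x} → P x → ¬ Q x) → ∀ xs → count P? xs + count Q? xs ≡ count R? xs
count-⊎ P? Q? R? P⊆R Q⊆R R⊆P⊎Q P#Q []       = refl
count-⊎ P? Q? R? P⊆R Q⊆R R⊆P⊎Q P#Q (x ∷ xs)
  with P? x | Q? x | R? x | count-⊎ P? Q? R? P⊆R Q⊆R R⊆P⊎Q P#Q xs
... | yes p | yes q | _     | _  = contradiction q (P#Q p)
... | yes p | no  _ | yes _ | eq = cong suc eq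
... | yes p | no  _ | no ¬r | _  = contradiction (P⊆R p) ¬r
... | no  _ | yes q | yes _ | eq = trans (ℕ.+-suc _ _) (cong suc eq)
... | no  _ | yes q | no ¬r | _  = contradiction (Q⊆R q) ¬r
... | no  _ | no  _ | no  _ | eq = eq
... | no ¬p | no ¬q | yes r | _  with R⊆P⊎Q r
...   | inj₁ p = contradiction p ¬p
...   | inj₂ q = contradiction q ¬q

count-vectors-suc : {P : Pred (Vec A (suc n)) 0ℓ} (P? : Decidable P) → ∀ x y →
                count P? (vectors (x ∷ y ∷ []) (suc n)) ≡
                count (P? ∘ (x Vec.∷_)) (vectors (x ∷ y ∷ []) n) + count (P? ∘ (y Vec.∷_)) (vectors (x ∷ y ∷ []) n)
count-vectors-suc {n = n} P? x y = begin
  count P? (map (x Vec.∷_) vs ++ (map (y Vec.∷_) vs ++ []))         ≡⟨ count-++ P? (map (x Vec.∷_) vs) _ ⟩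
  count P? (map (x Vec.∷_) vs) + count P? (map (y Vec.∷_) vs ++ [])
    ≡⟨ cong (λ ws → count P? (map (x Vec.∷_) vs) + count P? ws) (++-identityʳ (map (y Vec.∷_) vs)) ⟩
  count P? (map (x Vec.∷_) vs) + count P? (map (y Vec.∷_) vs)
    ≡⟨ cong₂ _+_ (count-map P? (x Vec.∷_) vs) (count-map P? (y Vec.∷_) vs) ⟩
  count (P? ∘ (x Vec.∷_)) vs + count (P? ∘ (y Vec.∷_)) vs           ∎
  where
  open ≡-Reasoning
  vs = vectors (x ∷ y ∷ []) n

infixl 6 _⊕_
_⊕_ : Subset n → Subset n → Subset n
_⊕_ = zipWith _xor_

⊕-cancelˡ : (U T : Subset n) → U ⊕ (U ⊕ T) ≡ T
⊕-cancelˡ Vec.[]       Vec.[]       = refl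
⊕-cancelˡ (u Vec.∷ U) (t Vec.∷ T) = cong₂ Vec._∷_
  (trans (sym (xor-assoc u u t)) (trans (cong (_xor t) (xor-same u)) (xor-identityˡ t)))
  (⊕-cancelˡ U T)

-- Translation permutes the subsets. Coordinate by coordinate, an `outside` in `U` keeps the two
-- halves of the list in place and an `inside` swaps them.
count-translate : {P : Pred (Subset n) 0ℓ} (P? : Decidable P) (U : Subset n) →
                  count (P? ∘ (U ⊕_)) (subsets n) ≡ count P? (subsets n)
count-translate P? Vec.[] = sym (count-map P? (Vec.[] ⊕_) (Vec.[] ∷ []))
count-translate P? (outside Vec.∷ U) =
  trans (count-vectors-suc (P? ∘ ((outside Vec.∷ U) ⊕_)) outside inside)
  (trans (cong₂ _+_ (count-translate (P? ∘ (outside Vec.∷_)) U) (count-translate (P? ∘ (inside Vec.∷_)) U))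
  (sym (count-vectors-suc P? outside inside)))
count-translate {suc n} P? (inside Vec.∷ U) =
  trans (count-vectors-suc (P? ∘ ((inside Vec.∷ U) ⊕_)) outside inside)
  (trans (cong₂ _+_ (count-translate (P? ∘ (inside Vec.∷_)) U) (count-translate (P? ∘ (outside Vec.∷_)) U))
  (trans (ℕ.+-comm (count (P? ∘ (inside Vec.∷_)) (subsets n)) (count (P? ∘ (outside Vec.∷_)) (subsets n)))
  (sym (count-vectors-suc P? outside inside))))

eval : Vec Sign n → Subset n → Sign
eval = subsetProduct Sign.*-1-rawMonoid

-- An index lying in both `T` and `U` contributes its sign twice, and a sign squares to `+`.
eval-⊕ : ∀ (θ : Vec Sign n) T U → eval θ (T ⊕ U) ≡ eval θ T Sign.* eval θ U
eval-⊕ Vec.[]       Vec.[]              Vec.[]              = refl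
eval-⊕ (s Vec.∷ θ) (outside Vec.∷ T) (outside Vec.∷ U) = eval-⊕ θ T U
eval-⊕ (s Vec.∷ θ) (outside Vec.∷ T) (inside  Vec.∷ U) = begin
  s Sign.* eval θ (T ⊕ U)             ≡⟨ cong (s Sign.*_) (eval-⊕ θ T U) ⟩
  s Sign.* (eval θ T Sign.* eval θ U) ≡⟨ Sign.*-assoc s _ _ ⟨
  s Sign.* eval θ T Sign.* eval θ U   ≡⟨ cong (Sign._* eval θ U) (Sign.*-comm s _) ⟩
  eval θ T Sign.* s Sign.* eval θ U   ≡⟨ Sign.*-assoc (eval θ T) s _ ⟩
  eval θ T Sign.* (s Sign.* eval θ U) ∎
  where open ≡-Reasoning
eval-⊕ (s Vec.∷ θ) (inside  Vec.∷ T) (outside Vec.∷ U) =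
  trans (cong (s Sign.*_) (eval-⊕ θ T U)) (sym (Sign.*-assoc s _ _))
eval-⊕ (s Vec.∷ θ) (inside  Vec.∷ T) (inside  Vec.∷ U) = begin
  eval θ (T ⊕ U)                                   ≡⟨ eval-⊕ θ T U ⟩
  eval θ T Sign.* eval θ U                         ≡⟨ cong (Sign._* (eval θ T Sign.* eval θ U)) (Sign.s*s≡+ s) ⟨
  s Sign.* s Sign.* (eval θ T Sign.* eval θ U)     ≡⟨ Sign-interchange s s _ _ ⟩
  s Sign.* eval θ T Sign.* (s Sign.* eval θ U)     ∎
  where open ≡-Reasoning

-- Closure under inverses is automatic: every subset is its own inverse under `⊕`.
record IsSubgroup (W : Pred (Subset n) 0ℓ) : Set where
  field
    contains-⊥ : W ⊥
    closed     : ∀ {T U} → W T → W U → W (T ⊕ U)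

IsCharacter : Pred (Subset n) 0ℓ → (Subset n → Sign) → Set
IsCharacter W χ = ∀ {T U} → W T → W U → χ (T ⊕ U) ≡ χ T Sign.* χ U

Extends : Pred (Subset n) 0ℓ → (Subset n → Sign) → Pred (Vec Sign n) 0ℓ
Extends W χ θ = ∀ T → W T → eval θ T ≡ χ T

extends? : {W : Pred (Subset n) 0ℓ} → Decidable W → (χ : Subset n → Sign) → Decidable (Extends W χ)
extends? W? χ θ = map′ (λ all T → ListAll.lookup all (∈-subsets T)) (λ all → ListAll.tabulate λ {T} _ → all T)
  (ListAll.all? (λ T → W? T →-dec (eval θ T Sign.≟ χ T)) (subsets _))

-- Induction on n, splitting W by its first coordinate.  If some U extended by 1 lies in W, the
-- two halves of W are translates of each other and the condition at U fixes the first sign of θ;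
-- otherwise that sign is free.
count-extensions : ∀ {n} {W : Pred (Subset n) 0ℓ} (W? : Decidable W) {χ} → IsSubgroup W → IsCharacter W χ →
                   count (extends? W? χ) (signMaps n) * count W? (subsets n) ≡ 2 ^ n
count-extensions {zero} {W} W? {χ} W≤ χ-hom = cong₂ _*_
  (cong length (filter-accept (extends? W? χ) {xs = []} λ { Vec.[] _ → sym χ[]≡+ }))
  (cong length (filter-accept W? {xs = []} w))
  where
  w : W Vec.[]
  w = IsSubgroup.contains-⊥ W≤

  χ[]≡+ : χ Vec.[] ≡ Sign.+
  χ[]≡+ = trans (χ-hom w w) (Sign.s*s≡+ (χ Vec.[]))
count-extensions {suc n} {W} W? {χ} W≤ χ-hom = count-cases (anySubset? W₁?)
  where
  open IsSubgroup W≤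
  open ≡-Reasoning

  W₀ W₁ : Pred (Subset n) 0ℓ
  W₀ T = W (outside Vec.∷ T)
  W₁ T = W (inside  Vec.∷ T)

  W₀? : Decidable W₀
  W₀? T = W? (outside Vec.∷ T)

  W₁? : Decidable W₁
  W₁? T = W? (inside Vec.∷ T)

  χ₀ : Subset n → Sign
  χ₀ T = χ (outside Vec.∷ T)

  #θ₀ #W₀ #W₁ : ℕ
  #θ₀ = count (extends? W₀? χ₀) (signMaps n)
  #W₀ = count W₀? (subsets n)
  #W₁ = count W₁? (subsets n)

  E? : Decidable (Extends W χ)
  E? = extends? W? χ

  #θ : Sign → ℕ
  #θ s = count (E? ∘ (s Vec.∷_)) (signMaps n)

  IH : #θ₀ * #W₀ ≡ 2 ^ n
  IH = count-extensions W₀? (record { contains-⊥ = contains-⊥ ; closed = closed }) χ-hom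

  restrict : ∀ {s θ} → Extends W χ (s Vec.∷ θ) → Extends W₀ χ₀ θ
  restrict ext T = ext (outside Vec.∷ T)

  count-cases : Dec (∃ W₁) → count E? (signMaps (suc n)) * count W? (subsets (suc n)) ≡ 2 ^ suc n
  count-cases (no ∄T) = begin
    count E? (signMaps (suc n)) * count W? (subsets (suc n))
      ≡⟨ cong₂ _*_ (count-vectors-suc E? Sign.+ Sign.-) (count-vectors-suc W? outside inside) ⟩
    (#θ Sign.+ + #θ Sign.-) * (#W₀ + #W₁)
      ≡⟨ cong₂ _*_ (cong₂ _+_ (free Sign.+) (free Sign.-))
           (cong (λ b → #W₀ + b) (count-none W₁? (λ T w → ∄T (T , w)) (subsets n))) ⟩
    (#θ₀ + #θ₀) * (#W₀ + 0)
      ≡⟨ solve 2 (λ a b → (a :+ a) :* (b :+ con 0) := con 2 :* (a :* b)) refl #θ₀ #W₀ ⟩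
    2 * (#θ₀ * #W₀)
      ≡⟨ cong (2 *_) IH ⟩
    2 ^ suc n ∎
    where
    open +-*-Solver
    extend : ∀ {s θ} → Extends W₀ χ₀ θ → Extends W χ (s Vec.∷ θ)
    extend ext (outside Vec.∷ T) w = ext T w
    extend ext (inside  Vec.∷ T) w = contradiction (T , w) ∄T

    free : ∀ s → #θ s ≡ #θ₀
    free s = count-cong (E? ∘ (s Vec.∷_)) (extends? W₀? χ₀) restrict extend (signMaps n)
  count-cases (yes (U , w)) = begin
    count E? (signMaps (suc n)) * count W? (subsets (suc n))
      ≡⟨ cong₂ _*_ (count-vectors-suc E? Sign.+ Sign.-) (count-vectors-suc W? outside inside) ⟩
    (#θ Sign.+ + #θ Sign.-) * (#W₀ + #W₁)
      ≡⟨ cong₂ (λ a b → a * (#W₀ + b)) determined #W₁≡#W₀ ⟩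
    #θ₀ * (#W₀ + #W₀)
      ≡⟨ solve 2 (λ a b → a :* (b :+ b) := con 2 :* (a :* b)) refl #θ₀ #W₀ ⟩
    2 * (#θ₀ * #W₀)
      ≡⟨ cong (2 *_) IH ⟩
    2 ^ suc n ∎
    where
    open +-*-Solver
    #W₁≡#W₀ : #W₁ ≡ #W₀
    #W₁≡#W₀ = trans (sym (count-translate W₁? U)) (count-cong (W₁? ∘ (U ⊕_)) W₀?
      (λ {T} v → subst W₀ (⊕-cancelˡ U T) (closed w v)) (λ v → closed w v) (subsets n))

    toW₀ : ∀ {T} → W₁ T → W₀ (U ⊕ T)
    toW₀ = closed w

    -- The vector `inside ∷ T` is the sum of `inside ∷ U` and `outside ∷ (U ⊕ T)`, both in `W`, and
    -- on these two `s ∷ θ` already agrees with `χ`.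
    extend : ∀ {s θ} → s Sign.* eval θ U ≡ χ (inside Vec.∷ U) → Extends W₀ χ₀ θ → Extends W χ (s Vec.∷ θ)
    extend {s} {θ} eq ext (outside Vec.∷ T) v = ext T v
    extend {s} {θ} eq ext (inside  Vec.∷ T) v = begin
      s Sign.* eval θ T                                ≡⟨ cong (λ V → s Sign.* eval θ V) (⊕-cancelˡ U T) ⟨
      s Sign.* eval θ (U ⊕ (U ⊕ T))                    ≡⟨ cong (s Sign.*_) (eval-⊕ θ U (U ⊕ T)) ⟩
      s Sign.* (eval θ U Sign.* eval θ (U ⊕ T))        ≡⟨ Sign.*-assoc s _ _ ⟨
      s Sign.* eval θ U Sign.* eval θ (U ⊕ T)          ≡⟨ cong₂ Sign._*_ eq (ext (U ⊕ T) (toW₀ v)) ⟩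
      χ (inside Vec.∷ U) Sign.* χ₀ (U ⊕ T)             ≡⟨ χ-hom w (toW₀ v) ⟨
      χ (inside Vec.∷ (U ⊕ (U ⊕ T)))                   ≡⟨ cong (λ V → χ (inside Vec.∷ V)) (⊕-cancelˡ U T) ⟩
      χ (inside Vec.∷ T)                               ∎

    sign-at-U : ∀ θ → ∃ λ s → s Sign.* eval θ U ≡ χ (inside Vec.∷ U)
    sign-at-U θ = χ (inside Vec.∷ U) Sign.* eval θ U , (begin
      χ (inside Vec.∷ U) Sign.* eval θ U Sign.* eval θ U    ≡⟨ Sign.*-assoc (χ (inside Vec.∷ U)) _ _ ⟩
      χ (inside Vec.∷ U) Sign.* (eval θ U Sign.* eval θ U)
        ≡⟨ cong (χ (inside Vec.∷ U) Sign.*_) (Sign.s*s≡+ (eval θ U)) ⟩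
      χ (inside Vec.∷ U) Sign.* Sign.+                      ≡⟨ Sign.*-identityʳ _ ⟩
      χ (inside Vec.∷ U)                                    ∎)

    someSign : ∀ {θ} → Extends W₀ χ₀ θ → Extends W χ (Sign.+ Vec.∷ θ) ⊎ Extends W χ (Sign.- Vec.∷ θ)
    someSign {θ} ext with sign-at-U θ
    ... | Sign.+ , eq = inj₁ (extend eq ext)
    ... | Sign.- , eq = inj₂ (extend eq ext)

    notBoth : ∀ {θ} → Extends W χ (Sign.+ Vec.∷ θ) → ¬ Extends W χ (Sign.- Vec.∷ θ)
    notBoth {θ} ext₊ ext₋ = contradiction
      (Sign.*-cancelʳ-≡ (eval θ U) Sign.+ Sign.- (trans (ext₊ (inside Vec.∷ U) w) (sym (ext₋ (inside Vec.∷ U) w)))) λ ()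

    determined : #θ Sign.+ + #θ Sign.- ≡ #θ₀
    determined = count-⊎ (E? ∘ (Sign.+ Vec.∷_)) (E? ∘ (Sign.- Vec.∷_)) (extends? W₀? χ₀)
      restrict restrict someSign notBoth (signMaps n)

-- Squarefree parts

coprime-*ʳ : ∀ {k m n} → ℕ.Coprime k m → ℕ.Coprime k n → ℕ.Coprime k (m * n)
coprime-*ʳ k⊥m k⊥n (d∣k , d∣mn) =
  k⊥n (d∣k , ℕ.coprime-divisor (λ (e∣d , e∣m) → k⊥m (ℕ.∣-trans e∣d d∣k , e∣m)) d∣mn)

coprime-∣* : ∀ {m n d} → ℕ.Coprime m n → m ℕ.∣ d → n ℕ.∣ d → m * n ℕ.∣ d
coprime-∣* {m} {n} m⊥n m∣qn (ℕ.divides q refl) =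
  ℕ.*-monoˡ-∣ n (ℕ.coprime-divisor m⊥n (subst (m ℕ.∣_) (ℕ.*-comm q n) m∣qn))

coprimeQuotients : ∀ x y .{{_ : ℤ.NonZero x}} → ∃ λ g → ∃₂ λ x′ y′ →
                   ℤ.NonZero g × x ≡ x′ ℤ.* g × y ≡ y′ ℤ.* g × ℤ.Coprime x′ y′
coprimeQuotients x y
  with Signed.∣ᵤ⇒∣ {+ ℕ.gcd ∣ x ∣ ∣ y ∣} {x} (ℕ.gcd[m,n]∣m ∣ x ∣ ∣ y ∣)
     | Signed.∣ᵤ⇒∣ {+ ℕ.gcd ∣ x ∣ ∣ y ∣} {y} (ℕ.gcd[m,n]∣n ∣ x ∣ ∣ y ∣)
... | Signed.divides x′ x≡ | Signed.divides y′ y≡ = + g , x′ , y′ , g≢0 , x≡ , y≡ , x′⊥y′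
  where
  g = ℕ.gcd ∣ x ∣ ∣ y ∣

  g≢0 : ℤ.NonZero (+ g)
  g≢0 = ℤ.≢-nonZero λ g≡0 → ≢-nonZero⁻¹ ∣ x ∣ (ℕ.gcd[m,n]≡0⇒m≡0 {∣ x ∣} {∣ y ∣} (ℤ.+-injective g≡0))

  scale : ∀ {z} z′ → z ≡ z′ ℤ.* + g → ∣ z ∣ ≡ ∣ z′ ∣ * g
  scale z′ eq = trans (cong ∣_∣ eq) (ℤ.abs-* z′ (+ g))

  x′⊥y′ : ℤ.Coprime x′ y′
  -- Writing the gcd as `1 * g` lets the common factor `g` be cancelled from all three places, which
  -- leaves gcd 1 for the cofactors.
  x′⊥y′ = ℕ.GCD≡1⇒coprime (ℕ.GCD-* {c = g} {{g≢0}}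
    (subst₂ (λ a b → ℕ.GCD a b (1 * g)) (scale x′ x≡) (scale y′ y≡)
      (subst (ℕ.GCD ∣ x ∣ ∣ y ∣) (sym (ℕ.*-identityˡ g)) (ℕ.gcd-GCD ∣ x ∣ ∣ y ∣))))

-- Put `x / y` in lowest terms `a / b`, so that `a² N = b² s`. Since `a²` is prime to `b`, it
-- divides `s`, and squarefreeness forces `a` to be 1 or -1.
squarefree-quotient : ∀ {s N} x y .{{_ : ℤ.NonZero x}} → Squarefree s → x ℤ.* x ℤ.* N ≡ y ℤ.* y ℤ.* s →
                      ∃ λ g → N ≡ g ℤ.* g ℤ.* s
squarefree-quotient {s} {N} x y s-sqfree x²N≡y²s with coprimeQuotients x y
... | g , a , b , g≢0 , refl , refl , a⊥b = b , (begin
  N                 ≡⟨ ℤ.*-identityˡ N ⟨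
  1ℤ ℤ.* N          ≡⟨ cong (ℤ._* N) a²≡1 ⟨
  a ℤ.* a ℤ.* N     ≡⟨ a²N≡b²s ⟩
  b ℤ.* b ℤ.* s     ∎)
  where
  open ≡-Reasoning

  instance
    _ = g≢0
    _ = ℤ.i*j≢0 g g

  rearrange : ∀ g a N → g ℤ.* g ℤ.* (a ℤ.* a ℤ.* N) ≡ a ℤ.* g ℤ.* (a ℤ.* g) ℤ.* N
  rearrange = solve-∀

  a²N≡b²s : a ℤ.* a ℤ.* N ≡ b ℤ.* b ℤ.* s
  a²N≡b²s = ℤ.*-cancelˡ-≡ (g ℤ.* g) _ _
    (trans (rearrange g a N) (trans x²N≡y²s (sym (rearrange g b s))))

  a²⊥b : ℤ.Coprime (a ℤ.* a) b
  a²⊥b = subst (λ c → ℕ.Coprime c ∣ b ∣) (sym (ℤ.abs-* a a))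
    (ℕ.sym (coprime-*ʳ (ℕ.sym a⊥b) (ℕ.sym a⊥b)))

  a²∣bbs : a ℤ.* a ℤ.∣ b ℤ.* (b ℤ.* s)
  a²∣bbs = Signed.∣⇒∣ᵤ (Signed.divides N
    (trans (sym (ℤ.*-assoc b b s)) (trans (sym a²N≡b²s) (ℤ.*-comm (a ℤ.* a) N))))

  ∣a∣≡1 : ∣ a ∣ ≡ 1
  ∣a∣≡1 = s-sqfree a (ℤ.coprime-divisor (a ℤ.* a) b s a²⊥b (ℤ.coprime-divisor (a ℤ.* a) b (b ℤ.* s) a²⊥b a²∣bbs))

  square-of-unit : ∀ z → ∣ z ∣ ≡ 1 → z ℤ.* z ≡ 1ℤ
  square-of-unit (+ 1)         refl = refl
  square-of-unit (ℤ.-[1+ 0 ]) refl = refl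

  a²≡1 : a ℤ.* a ≡ 1ℤ
  a²≡1 = square-of-unit a ∣a∣≡1

squarefree⇒nonZero : ∀ {s} → Squarefree s → ℤ.NonZero s
squarefree⇒nonZero {s} s-sqfree = ℤ.≢-nonZero {s} λ { refl → contradiction (s-sqfree 0ℤ (0 ℕ.∣0)) λ () }

-- With h = gcd s₁ s₂, s₁ = a h and s₂ = b h, the squarefree s₃ already divides a b, and coprime
-- a and b both divide d.
squarefree-product-∣ : ∀ {s₁ s₂ s₃ d g} .{{_ : ℤ.NonZero s₁}} → Squarefree s₃ → s₁ ℤ.∣ d → s₂ ℤ.∣ d →
                       s₁ ℤ.* s₂ ≡ g ℤ.* g ℤ.* s₃ → s₃ ℤ.∣ d
squarefree-product-∣ {s₁} {s₂} {s₃} {d} {g} s₃-sqfree s₁∣d s₂∣d s₁s₂≡g²s₃ with coprimeQuotients s₁ s₂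
... | h , a , b , h≢0 , refl , refl , a⊥b =
  ℕ.∣-trans s₃∣ab (subst (ℕ._∣ ∣ d ∣) (sym (ℤ.abs-* a b)) (coprime-∣* a⊥b (∣d a s₁∣d) (∣d b s₂∣d)))
  where
  ∣d : ∀ c → c ℤ.* h ℤ.∣ d → c ℤ.∣ d
  ∣d c ch∣d = ℕ.∣-trans (ℕ.m∣m*n ∣ h ∣) (subst (ℕ._∣ ∣ d ∣) (ℤ.abs-* c h) ch∣d)

  rearrange : ∀ h a b → h ℤ.* h ℤ.* (a ℤ.* b) ≡ a ℤ.* h ℤ.* (b ℤ.* h)
  rearrange = solve-∀

  s₃∣ab : s₃ ℤ.∣ a ℤ.* b
  -- From `h² (a b) = s₁ s₂ = g² s₃` it follows that `a b` itself is a square times `s₃`.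
  s₃∣ab with squarefree-quotient h g {{h≢0}} s₃-sqfree (trans (rearrange h a b) s₁s₂≡g²s₃)
  ... | k , ab≡k²s₃ = Signed.∣⇒∣ᵤ {s₃} (Signed.divides (k ℤ.* k) ab≡k²s₃)

-- Elements of `T ∩ U` occur in both products on the left, hence the square; the remaining ones make
-- up `T ⊕ U`.
∏-⊕ : ∀ {n} (S : Vec ℤ n) T U → ∏ S T ℤ.* ∏ S U ≡ ∏ S (T ∩ U) ℤ.* ∏ S (T ∩ U) ℤ.* ∏ S (T ⊕ U)
∏-⊕ Vec.[]      Vec.[]              Vec.[]              = refl
∏-⊕ (s Vec.∷ S) (outside Vec.∷ T) (outside Vec.∷ U) = ∏-⊕ S T U
∏-⊕ (s Vec.∷ S) (outside Vec.∷ T) (inside  Vec.∷ U) =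
  trans (x*yz≡y*xz (∏ S T) s (∏ S U)) (trans (cong (s ℤ.*_) (∏-⊕ S T U))
    (x*yz≡y*xz s (∏ S (T ∩ U) ℤ.* ∏ S (T ∩ U)) (∏ S (T ⊕ U))))
∏-⊕ (s Vec.∷ S) (inside  Vec.∷ T) (outside Vec.∷ U) =
  trans (ℤ.*-assoc s (∏ S T) (∏ S U)) (trans (cong (s ℤ.*_) (∏-⊕ S T U))
    (x*yz≡y*xz s (∏ S (T ∩ U) ℤ.* ∏ S (T ∩ U)) (∏ S (T ⊕ U))))
∏-⊕ (s Vec.∷ S) (inside  Vec.∷ T) (inside  Vec.∷ U) =
  trans (lemma₁ s (∏ S T) (∏ S U)) (trans (cong (s ℤ.* s ℤ.*_) (∏-⊕ S T U)) (lemma₂ s (∏ S (T ∩ U)) (∏ S (T ⊕ U))))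
  where
  lemma₁ : ∀ s a b → s ℤ.* a ℤ.* (s ℤ.* b) ≡ s ℤ.* s ℤ.* (a ℤ.* b)
  lemma₁ = solve-∀

  lemma₂ : ∀ s a b → s ℤ.* s ℤ.* (a ℤ.* a ℤ.* b) ≡ s ℤ.* a ℤ.* (s ℤ.* a) ℤ.* b
  lemma₂ = solve-∀

module _ {n : ℕ} (S : Vec ℤ n) (S≢0 : All ℤ.NonZero S) where

  sqfSet-part : ∀ T → IsSquarefreePart (∏ S T) (sqfSet S S≢0 T)
  sqfSet-part T = proj₂ (squarefreePart (∏ S T) {{∏-nonZero S≢0 T}})

  sqfSet-squarefree : ∀ T → Squarefree (sqfSet S S≢0 T)
  sqfSet-squarefree T = IsSquarefreePart.squarefree (sqfSet-part T)

  -- Each product differs from its squarefree part by a square. Inserting these squares into `∏-⊕`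
  -- relates the two sides up to the squares of `m T * m U` and `∏ S (T ∩ U) * m (T ⊕ U)`, and
  -- squarefreeness of the part of `T ⊕ U` makes their quotient integral.
  sqfSet-⊕ : ∀ T U → ∃ λ g → sqfSet S S≢0 T ℤ.* sqfSet S S≢0 U ≡ g ℤ.* g ℤ.* sqfSet S S≢0 (T ⊕ U)
  sqfSet-⊕ T U = squarefree-quotient (m T ℤ.* m U) (∏ S (T ∩ U) ℤ.* m (T ⊕ U))
    {{ℤ.i*j≢0 (m T) (m U) {{m≢0 T}} {{m≢0 U}}}} (sqfSet-squarefree (T ⊕ U)) (begin
    m T ℤ.* m U ℤ.* (m T ℤ.* m U) ℤ.* (s T ℤ.* s U)
      ≡⟨ rearrange₁ (m T) (m U) (s T) (s U) ⟩
    s T ℤ.* (m T ℤ.* m T) ℤ.* (s U ℤ.* (m U ℤ.* m U))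
      ≡⟨ cong₂ ℤ._*_ (∏≡ T) (∏≡ U) ⟨
    ∏ S T ℤ.* ∏ S U
      ≡⟨ ∏-⊕ S T U ⟩
    ∏ S (T ∩ U) ℤ.* ∏ S (T ∩ U) ℤ.* ∏ S (T ⊕ U)
      ≡⟨ cong (∏ S (T ∩ U) ℤ.* ∏ S (T ∩ U) ℤ.*_) (∏≡ (T ⊕ U)) ⟩
    ∏ S (T ∩ U) ℤ.* ∏ S (T ∩ U) ℤ.* (s (T ⊕ U) ℤ.* (m (T ⊕ U) ℤ.* m (T ⊕ U)))
      ≡⟨ rearrange₂ (∏ S (T ∩ U)) (s (T ⊕ U)) (m (T ⊕ U)) ⟩
    ∏ S (T ∩ U) ℤ.* m (T ⊕ U) ℤ.* (∏ S (T ∩ U) ℤ.* m (T ⊕ U)) ℤ.* s (T ⊕ U) ∎)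
    where
    open ≡-Reasoning

    s m : Subset n → ℤ
    s = sqfSet S S≢0
    m T = proj₁ (IsSquarefreePart.square (sqfSet-part T))

    ∏≡ : ∀ T → ∏ S T ≡ s T ℤ.* (m T ℤ.* m T)
    ∏≡ T = proj₂ (IsSquarefreePart.square (sqfSet-part T))

    m≢0 : ∀ T → ℤ.NonZero (m T)
    m≢0 T = ℤ.≢-nonZero {m T} λ m≡0 → ≢-nonZero⁻¹ ∣ ∏ S T ∣ {{∏-nonZero S≢0 T}}
      (cong ∣_∣ (trans (∏≡ T) (trans (cong (λ z → s T ℤ.* (z ℤ.* z)) m≡0) (ℤ.*-zeroʳ (s T)))))

    rearrange₁ : ∀ a b c d → a ℤ.* b ℤ.* (a ℤ.* b) ℤ.* (c ℤ.* d) ≡ c ℤ.* (a ℤ.* a) ℤ.* (d ℤ.* (b ℤ.* b))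
    rearrange₁ = solve-∀

    rearrange₂ : ∀ a b c → a ℤ.* a ℤ.* (b ℤ.* (c ℤ.* c)) ≡ a ℤ.* c ℤ.* (a ℤ.* c) ℤ.* b
    rearrange₂ = solve-∀

-- Multiplicativity of the Kronecker symbol

∣-%ℕ : ∀ a n .{{_ : NonZero n}} → + n ∣ₛ a ℤ.- + (a %ℕ n)
∣-%ℕ a n = Signed.divides (a /ℕ n)
  (trans (cong (ℤ._- + (a %ℕ n)) (ℤ.a≡a%ℕn+[a/ℕn]*n a n)) (lemma (+ (a %ℕ n)) (a /ℕ n ℤ.* + n)))
  where
  lemma : ∀ r m → r ℤ.+ m ℤ.- r ≡ m
  lemma = solve-∀

mod-sym : ∀ {k} a b → k ∣ₛ a ℤ.- b → k ∣ₛ b ℤ.- a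
mod-sym {k} a b k∣a-b = subst (k ∣ₛ_) (lemma a b) (Signed.∣m⇒∣-m k∣a-b)
  where
  lemma : ∀ a b → ℤ.- (a ℤ.- b) ≡ b ℤ.- a
  lemma = solve-∀

mod-trans : ∀ {k} a b c → k ∣ₛ a ℤ.- b → k ∣ₛ b ℤ.- c → k ∣ₛ a ℤ.- c
mod-trans {k} a b c k∣a-b k∣b-c = subst (k ∣ₛ_) (lemma a b c) (Signed.∣m∣n⇒∣m+n k∣a-b k∣b-c)
  where
  lemma : ∀ a b c → a ℤ.- b ℤ.+ (b ℤ.- c) ≡ a ℤ.- c
  lemma = solve-∀

%ℕ≡⇒∣- : ∀ a b n .{{_ : NonZero n}} → a %ℕ n ≡ b %ℕ n → + n ∣ₛ a ℤ.- b
%ℕ≡⇒∣- a b n eq = mod-trans a (+ (a %ℕ n)) b (∣-%ℕ a n)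
  (mod-sym b (+ (a %ℕ n)) (subst (λ r → + n ∣ₛ b ℤ.- + r) (sym eq) (∣-%ℕ b n)))

∣<⇒≡0 : ∀ {m n} → m ℕ.∣ n → n < m → n ≡ 0
∣<⇒≡0 {n = zero}  _   _   = refl
∣<⇒≡0 {n = suc _} m∣n n<m = contradiction m∣n (ℕ.>⇒∤ n<m)

-- The distance of two naturals is at most the larger of them, here less than `n`, and the only
-- multiple of `n` that small is 0.
residues-unique : ∀ {r s n} → r < n → s < n → + n ∣ₛ + r ℤ.- + s → r ≡ s
residues-unique {r} {s} {n} r<n s<n n∣r-s = ℤ.+-injective (ℤ.i-j≡0⇒i≡j (+ r) (+ s)
  (ℤ.∣i∣≡0⇒i≡0 (∣<⇒≡0 (Signed.∣⇒∣ᵤ n∣r-s) ∣r-s∣<n)))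
  where
  ∣r-s∣<n : ∣ + r ℤ.- + s ∣ < n
  ∣r-s∣<n = ℕ.≤-<-trans
    (ℕ.≤-trans (ℕ.≤-reflexive (cong ∣_∣ (ℤ.m-n≡m⊖n r s))) (ℤ.∣m⊝n∣≤m⊔n r s))
    (ℕ.⊔-lub r<n s<n)

∣-⇒%ℕ≡ : ∀ a b n .{{_ : NonZero n}} → + n ∣ₛ a ℤ.- b → a %ℕ n ≡ b %ℕ n
∣-⇒%ℕ≡ a b n n∣a-b = residues-unique (ℤ.n%ℕd<d a n) (ℤ.n%ℕd<d b n)
  (mod-trans (+ (a %ℕ n)) a (+ (b %ℕ n)) (mod-sym a _ (∣-%ℕ a n))
    (mod-trans a b (+ (b %ℕ n)) n∣a-b (∣-%ℕ b n)))

%ℕ-distrib-* : ∀ a b n .{{_ : NonZero n}} → (a ℤ.* b) %ℕ n ≡ ((a %ℕ n) * (b %ℕ n)) ℕ.% n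
%ℕ-distrib-* a b n = ∣-⇒%ℕ≡ (a ℤ.* b) (+ ((a %ℕ n) * (b %ℕ n))) n
  (subst (λ rs → + n ∣ₛ a ℤ.* b ℤ.- rs) (sym (ℤ.pos-* r s))
    (subst (+ n ∣ₛ_) (lemma a b (+ r) (+ s))
      (Signed.∣m∣n⇒∣m+n (Signed.∣n⇒∣m*n a (∣-%ℕ b n)) (Signed.∣n⇒∣m*n (+ s) (∣-%ℕ a n)))))
  where
  r = a %ℕ n
  s = b %ℕ n
  lemma : ∀ a b r s → a ℤ.* (b ℤ.- s) ℤ.+ s ℤ.* (a ℤ.- r) ≡ a ℤ.* b ℤ.- r ℤ.* s
  lemma = solve-∀

%ℕ-cong-* : ∀ n .{{_ : NonZero n}} a b c d → a %ℕ n ≡ c %ℕ n → b %ℕ n ≡ d %ℕ n → (a ℤ.* b) %ℕ n ≡ (c ℤ.* d) %ℕ n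
%ℕ-cong-* n a b c d a≡c b≡d = trans (%ℕ-distrib-* a b n)
  (trans (cong₂ (λ r s → (r * s) ℕ.% n) a≡c b≡d) (sym (%ℕ-distrib-* c d n)))

residue : ∀ n .{{_ : NonZero n}} → ℤ → Fin n
residue n a = fromℕ< (ℤ.n%ℕd<d a n)

%ℕ-residue : ∀ n .{{_ : NonZero n}} a → a %ℕ n ≡ + toℕ (residue n a) %ℕ n
%ℕ-residue n a = sym (trans (cong (ℕ._% n) (Fin.toℕ-fromℕ< (ℤ.n%ℕd<d a n))) (ℕ.m<n⇒m%n≡m (ℤ.n%ℕd<d a n)))

-- The symbol at 2

kronecker₂-cong : ∀ a b → a %ℕ 8 ≡ b %ℕ 8 → kronecker₂ a ≡ kronecker₂ b
kronecker₂-cong a b eq with a %ℕ 8 | b %ℕ 8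
kronecker₂-cong a b refl | r | .r = refl

-- Both sides depend on residues modulo 8 alone, so deciding the 64 pairs of residues is enough.
-- Even arguments are included; there both sides are 0.
kronecker₂-* : ∀ a b → kronecker₂ (a ℤ.* b) ≡ kronecker₂ a ℤ.* kronecker₂ b
kronecker₂-* a b = begin
  kronecker₂ (a ℤ.* b)
    ≡⟨ kronecker₂-cong (a ℤ.* b) (+ toℕ r ℤ.* + toℕ s)
         (%ℕ-cong-* 8 a b (+ toℕ r) (+ toℕ s) (%ℕ-residue 8 a) (%ℕ-residue 8 b)) ⟩
  kronecker₂ (+ toℕ r ℤ.* + toℕ s)       ≡⟨ table r s ⟩
  kronecker₂ (+ toℕ r) ℤ.* kronecker₂ (+ toℕ s)
    ≡⟨ cong₂ ℤ._*_ (kronecker₂-cong a (+ toℕ r) (%ℕ-residue 8 a)) (kronecker₂-cong b (+ toℕ s) (%ℕ-residue 8 b)) ⟨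
  kronecker₂ a ℤ.* kronecker₂ b          ∎
  where
  open ≡-Reasoning

  r = residue 8 a
  s = residue 8 b

  table : ∀ (r s : Fin 8) → kronecker₂ (+ toℕ r ℤ.* + toℕ s) ≡ kronecker₂ (+ toℕ r) ℤ.* kronecker₂ (+ toℕ s)
  table = toWitness {a? = Fin.all? λ r → Fin.all? λ s →
    kronecker₂ (+ toℕ r ℤ.* + toℕ s) ℤ.≟ kronecker₂ (+ toℕ r) ℤ.* kronecker₂ (+ toℕ s)} tt

IsUnit : ℤ → Set
IsUnit x = x ≡ 1ℤ ⊎ x ≡ -1ℤ

%ℕ-∣ : ∀ {m} a n .{{_ : NonZero n}} → m ℕ.∣ n → m ℕ.∣ a %ℕ n → + m ℤ.∣ a
%ℕ-∣ {m} a n m∣n m∣r = Signed.∣⇒∣ᵤ {+ m} (subst (+ m ∣ₛ_) (lemma a (+ (a %ℕ n)))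
  (Signed.∣m∣n⇒∣m+n (Signed.∣-trans (Signed.∣ᵤ⇒∣ {+ m} {+ n} m∣n) (∣-%ℕ a n)) (Signed.∣ᵤ⇒∣ {+ m} {+ (a %ℕ n)} m∣r)))
  where
  lemma : ∀ a r → a ℤ.- r ℤ.+ r ≡ a
  lemma = solve-∀

kronecker₂-unit : ∀ a → ¬ + 2 ℤ.∣ a → IsUnit (kronecker₂ a)
kronecker₂-unit a 2∤a with a %ℕ 8 | ℤ.n%ℕd<d a 8 | %ℕ-∣ {2} a 8 (ℕ.divides 4 refl)
... | 0 | _ | even = contradiction (even (ℕ.divides 0 refl)) 2∤a
... | 1 | _ | _    = inj₁ refl
... | 2 | _ | even = contradiction (even (ℕ.divides 1 refl)) 2∤a
... | 3 | _ | _    = inj₂ refl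
... | 4 | _ | even = contradiction (even (ℕ.divides 2 refl)) 2∤a
... | 5 | _ | _    = inj₂ refl
... | 6 | _ | even = contradiction (even (ℕ.divides 3 refl)) 2∤a
... | 7 | _ | _    = inj₁ refl
... | suc (suc (suc (suc (suc (suc (suc (suc _))))))) | s≤s (s≤s (s≤s (s≤s (s≤s (s≤s (s≤s (s≤s ()))))))) | _

-- Squares modulo a prime and the Legendre symbol

euclid : ∀ {p} → Prime p → ∀ a b → + p ∣ₛ a ℤ.* b → + p ∣ₛ a ⊎ + p ∣ₛ b
euclid {p} p-prime a b p∣ab
  with euclidsLemma ∣ a ∣ ∣ b ∣ p-prime (subst (p ℕ.∣_) (ℤ.abs-* a b) (Signed.∣⇒∣ᵤ p∣ab))
... | inj₁ p∣a = inj₁ (Signed.∣ᵤ⇒∣ p∣a)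
... | inj₂ p∣b = inj₂ (Signed.∣ᵤ⇒∣ p∣b)

∤⇒coprime : ∀ {p m} → Prime p → ¬ p ℕ.∣ m → ℕ.Coprime p m
∤⇒coprime p-prime p∤m (k∣p , k∣m) with prime⇒irreducible p-prime k∣p
... | inj₁ k≡1  = k≡1
... | inj₂ refl = contradiction k∣m p∤m

pos-1+* : ∀ w n x p → 1 + w * n ≡ x * p → 1ℤ ℤ.+ + w ℤ.* + n ≡ + x ℤ.* + p
pos-1+* w n x p eq = trans (cong (λ m → 1ℤ ℤ.+ m) (sym (ℤ.pos-* w n))) (trans (cong +_ eq) (ℤ.pos-* x p))

-- Bézout for `p` and `∣ y ∣` over the naturals comes in two forms, according to which multiple
-- exceeds the other by 1; the coefficient of `∣ y ∣` is the inverse up to a sign fixed by the form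
-- and by the sign of `y`.
inverse : ∀ {p} → Prime p → ∀ y → ¬ + p ∣ₛ y → ∃ λ z → + p ∣ₛ y ℤ.* z ℤ.- 1ℤ
inverse {p} p-prime (+ n) p∤n with ℕ.coprime-Bézout (∤⇒coprime p-prime (p∤n ∘ Signed.∣ᵤ⇒∣))
... | ℕ.Bézout.+- x w eq = ℤ.- + w , Signed.divides (ℤ.- + x)
  (trans (lemma (+ n) (+ w)) (trans (cong ℤ.-_ (pos-1+* w n x p eq)) (ℤ.neg-distribˡ-* (+ x) (+ p))))
  where
  lemma : ∀ n w → n ℤ.* (ℤ.- w) ℤ.- 1ℤ ≡ ℤ.- (1ℤ ℤ.+ w ℤ.* n)
  lemma = solve-∀
... | ℕ.Bézout.-+ x w eq = + w , Signed.divides (+ x)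
  (trans (cong (ℤ._- 1ℤ) (trans (ℤ.*-comm (+ n) (+ w)) (sym (pos-1+* x p w n eq)))) (lemma (+ x ℤ.* + p)))
  where
  lemma : ∀ m → 1ℤ ℤ.+ m ℤ.- 1ℤ ≡ m
  lemma = solve-∀
inverse {p} p-prime ℤ.-[1+ n ] p∤y with inverse p-prime (+ suc n) (p∤y ∘ Signed.∣m⇒∣-m)
... | z , p∣ = ℤ.- z , subst (λ m → + p ∣ₛ m ℤ.- 1ℤ) (lemma (+ suc n) z) p∣
  where
  lemma : ∀ y z → y ℤ.* z ≡ (ℤ.- y) ℤ.* (ℤ.- z)
  lemma = solve-∀

-- The definition searches for a root among the residues in `Fin p`, which keeps it decidable.
-- Reduction modulo `p` lets any integer root serve.
square⇒IsSquareMod : ∀ {p a} .{{_ : NonZero p}} u → + p ∣ₛ u ℤ.* u ℤ.- a → IsSquareMod a p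
square⇒IsSquareMod {p} {a} u p∣u²-a = fromℕ< r<p , Signed.∣⇒∣ᵤ {+ p}
  (subst (λ r → + p ∣ₛ + r ℤ.* + r ℤ.- a) (sym (Fin.toℕ-fromℕ< r<p))
    (subst (+ p ∣ₛ_) (lemma u (+ (u %ℕ p)) a)
      (Signed.∣m∣n⇒∣m-n p∣u²-a (Signed.∣n⇒∣m*n (u ℤ.+ + (u %ℕ p)) (∣-%ℕ u p)))))
  where
  r<p : u %ℕ p < p
  r<p = ℤ.n%ℕd<d u p
  lemma : ∀ u r a → u ℤ.* u ℤ.- a ℤ.- (u ℤ.+ r) ℤ.* (u ℤ.- r) ≡ r ℤ.* r ℤ.- a
  lemma = solve-∀

IsSquareMod⇒square : ∀ {p a} → IsSquareMod a p → ∃ λ u → + p ∣ₛ u ℤ.* u ℤ.- a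
IsSquareMod⇒square {p} {a} (x , p∣) = + toℕ x , Signed.∣ᵤ⇒∣ {+ p} {+ toℕ x ℤ.* + toℕ x ℤ.- a} p∣

module _ {p : ℕ} (p-prime : Prime p) where

  private
    instance
      p≢0 : NonZero p
      p≢0 = prime⇒nonZero p-prime

  -- Modulo `p`, `c` is the square of `x / y`, with the inverse `z` of `y` standing for `1 / y`.
  square-cancel : ∀ x y c → ¬ + p ∣ₛ y → + p ∣ₛ y ℤ.* y ℤ.* c ℤ.- x ℤ.* x → IsSquareMod c p
  square-cancel x y c p∤y p∣y²c-x² with inverse p-prime y p∤y
  ... | z , p∣yz-1 = square⇒IsSquareMod (x ℤ.* z) (subst (+ p ∣ₛ_) (lemma x y z c)
    (Signed.∣m∣n⇒∣m-n (Signed.∣n⇒∣m*n (c ℤ.* (y ℤ.* z ℤ.+ 1ℤ)) p∣yz-1) (Signed.∣n⇒∣m*n (z ℤ.* z) p∣y²c-x²)))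
    where
    lemma : ∀ x y z c → c ℤ.* (y ℤ.* z ℤ.+ 1ℤ) ℤ.* (y ℤ.* z ℤ.- 1ℤ) ℤ.- z ℤ.* z ℤ.* (y ℤ.* y ℤ.* c ℤ.- x ℤ.* x)
                      ≡ x ℤ.* z ℤ.* (x ℤ.* z) ℤ.- c
    lemma = solve-∀

  square*square : ∀ {a b} → IsSquareMod a p → IsSquareMod b p → IsSquareMod (a ℤ.* b) p
  square*square {a} {b} a-sq b-sq with IsSquareMod⇒square a-sq | IsSquareMod⇒square b-sq
  ... | x , p∣x²-a | y , p∣y²-b = square⇒IsSquareMod (x ℤ.* y) (subst (+ p ∣ₛ_) (lemma x y a b)
    (Signed.∣m∣n⇒∣m+n (Signed.∣n⇒∣m*n (x ℤ.* x) p∣y²-b) (Signed.∣n⇒∣m*n b p∣x²-a)))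
    where
    lemma : ∀ x y a b → x ℤ.* x ℤ.* (y ℤ.* y ℤ.- b) ℤ.+ b ℤ.* (x ℤ.* x ℤ.- a) ≡ x ℤ.* y ℤ.* (x ℤ.* y) ℤ.- a ℤ.* b
    lemma = solve-∀

  -- With `a ≡ x²` and `a b ≡ w²`, `b` is the square of `w / x`; `x` is invertible because `p` does
  -- not divide `a`.
  square*⇒square : ∀ {a b} → ¬ + p ∣ₛ a → IsSquareMod a p → IsSquareMod (a ℤ.* b) p → IsSquareMod b p
  square*⇒square {a} {b} p∤a a-sq ab-sq with IsSquareMod⇒square a-sq | IsSquareMod⇒square ab-sq
  ... | x , p∣x²-a | w , p∣w²-ab = square-cancel w x b p∤x (subst (+ p ∣ₛ_) (lemma x w a b)
    (Signed.∣m∣n⇒∣m-n (Signed.∣n⇒∣m*n b p∣x²-a) p∣w²-ab))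
    where
    lemma : ∀ x w a b → b ℤ.* (x ℤ.* x ℤ.- a) ℤ.- (w ℤ.* w ℤ.- a ℤ.* b) ≡ x ℤ.* x ℤ.* b ℤ.- w ℤ.* w
    lemma = solve-∀
    lemma′ : ∀ x a → x ℤ.* x ℤ.- (x ℤ.* x ℤ.- a) ≡ a
    lemma′ = solve-∀
    p∤x : ¬ + p ∣ₛ x
    p∤x p∣x = p∤a (subst (+ p ∣ₛ_) (lemma′ x a) (Signed.∣m∣n⇒∣m-n (Signed.∣n⇒∣m*n x p∣x) p∣x²-a))

  module _ (h : ℕ) (p≡1+2h : p ≡ suc (h + h)) where

    h<p : h < p
    h<p = subst (h <_) (sym p≡1+2h) (s≤s (ℕ.m≤m+n h h))

    -- The prime divides `i - j` or `i + j`. The sum is at most `2 h`, below `p`, so in the second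
    -- case both numbers are 0.
    squares-distinct : ∀ {i j} → i ℕ.≤ h → j ℕ.≤ h → + p ∣ₛ + i ℤ.* + i ℤ.- + j ℤ.* + j → i ≡ j
    squares-distinct {i} {j} i≤h j≤h p∣i²-j²
      with euclid p-prime (+ i ℤ.- + j) (+ i ℤ.+ + j) (subst (+ p ∣ₛ_) (lemma (+ i) (+ j)) p∣i²-j²)
      where
      lemma : ∀ i j → i ℤ.* i ℤ.- j ℤ.* j ≡ (i ℤ.- j) ℤ.* (i ℤ.+ j)
      lemma = solve-∀
    ... | inj₁ p∣i-j = residues-unique (ℕ.≤-<-trans i≤h h<p) (ℕ.≤-<-trans j≤h h<p) p∣i-j
    ... | inj₂ p∣i+j = trans (ℕ.m+n≡0⇒m≡0 i i+j≡0) (sym (ℕ.m+n≡0⇒n≡0 i i+j≡0))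
      where
      i+j≡0 : i + j ≡ 0
      i+j≡0 = ∣<⇒≡0 (Signed.∣⇒∣ᵤ p∣i+j) (subst (i + j <_) (sym p≡1+2h) (s≤s (ℕ.+-mono-≤ i≤h j≤h)))

    -- Pigeonhole: the h + 1 squares i², the h values a j² (j ≠ 0) and b are p + 1 integers, so two of
    -- them agree modulo p; the only collision possible is a j² ≡ b, which makes a b ≡ (a j)².
    nonsquare*nonsquare : ∀ {a b} → ¬ + p ∣ₛ a → ¬ IsSquareMod a p → ¬ IsSquareMod b p → IsSquareMod (a ℤ.* b) p
    nonsquare*nonsquare {a} {b} p∤a a-nonsq b-nonsq =
      collide (Fin.pigeonhole p<2h+2 (λ k → fromℕ< (ℤ.n%ℕd<d (value (Fin.splitAt (suc h) k)) p)))
      where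
      Index = Fin (suc h) ⊎ Fin (suc h)

      square : Fin (suc h) → ℤ
      square i = + toℕ i ℤ.* + toℕ i

      -- The index of a · 0², which would duplicate 0², carries b instead.
      value : Index → ℤ
      value (inj₁ i)             = square i
      value (inj₂ Fin.zero)      = b
      value (inj₂ j@(Fin.suc _)) = a ℤ.* square j

      p<2h+2 : p < suc h + suc h
      p<2h+2 = subst (_< suc h + suc h) (sym p≡1+2h) (ℕ.≤-reflexive (cong suc (sym (ℕ.+-suc h h))))

      toℕ≤h : ∀ (i : Fin (suc h)) → toℕ i ℕ.≤ h
      toℕ≤h = Fin.toℕ≤pred[n]

      p∤suc : ∀ (j : Fin h) → ¬ + p ∣ₛ + suc (toℕ j)
      p∤suc j p∣ = contradiction (∣<⇒≡0 (Signed.∣⇒∣ᵤ p∣) (ℕ.≤-<-trans (Fin.toℕ<n j) h<p)) λ ()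

      square-≢ : ∀ {i j} → i ≢ j → ¬ + p ∣ₛ square i ℤ.- square j
      square-≢ {i} {j} i≢j p∣ = i≢j (Fin.toℕ-injective (squares-distinct (toℕ≤h i) (toℕ≤h j) p∣))

      -- Such a congruence would make `a` the square of a quotient, as the root on the right lies
      -- between 1 and `h` and is invertible.
      square-≢-a*square : ∀ i j → ¬ + p ∣ₛ square i ℤ.- a ℤ.* square (Fin.suc j)
      square-≢-a*square i j p∣ = a-nonsq (square-cancel (+ toℕ i) (+ suc (toℕ j)) a (p∤suc j)
        (subst (λ m → + p ∣ₛ m ℤ.- square i) (ℤ.*-comm a (square (Fin.suc j))) (mod-sym (square i) _ p∣)))

      square-≢-b : ∀ i → ¬ + p ∣ₛ square i ℤ.- b
      square-≢-b i p∣ = b-nonsq (square⇒IsSquareMod (+ toℕ i) p∣)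

      a*square≡b : ∀ j → + p ∣ₛ a ℤ.* square j ℤ.- b → IsSquareMod (a ℤ.* b) p
      a*square≡b j p∣ = square⇒IsSquareMod (a ℤ.* + toℕ j)
        (subst (+ p ∣ₛ_) (lemma a b (+ toℕ j)) (Signed.∣n⇒∣m*n a p∣))
        where
        lemma : ∀ a b j → a ℤ.* (a ℤ.* (j ℤ.* j) ℤ.- b) ≡ a ℤ.* j ℤ.* (a ℤ.* j) ℤ.- a ℤ.* b
        lemma = solve-∀

      a*square-cancel : ∀ x y → + p ∣ₛ a ℤ.* x ℤ.- a ℤ.* y → + p ∣ₛ x ℤ.- y
      a*square-cancel x y p∣ with euclid p-prime a (x ℤ.- y) (subst (+ p ∣ₛ_) (lemma a x y) p∣)
        where
        lemma : ∀ a x y → a ℤ.* x ℤ.- a ℤ.* y ≡ a ℤ.* (x ℤ.- y)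
        lemma = solve-∀
      ... | inj₁ p∣a   = contradiction p∣a p∤a
      ... | inj₂ p∣x-y = p∣x-y

      collision : ∀ u v → u ≢ v → + p ∣ₛ value u ℤ.- value v → IsSquareMod (a ℤ.* b) p
      collision (inj₁ i)           (inj₁ j)           u≢v p∣ = contradiction p∣ (square-≢ (u≢v ∘ cong inj₁))
      collision (inj₁ i)           (inj₂ Fin.zero)    u≢v p∣ = contradiction p∣ (square-≢-b i)
      collision (inj₁ i)           (inj₂ (Fin.suc j)) u≢v p∣ = contradiction p∣ (square-≢-a*square i j)
      collision (inj₂ Fin.zero)    (inj₁ j)           u≢v p∣ = contradiction (mod-sym b _ p∣) (square-≢-b j)
      collision (inj₂ Fin.zero)    (inj₂ Fin.zero)    u≢v p∣ = contradiction refl u≢v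
      collision (inj₂ Fin.zero)    (inj₂ j@(Fin.suc _)) u≢v p∣ = a*square≡b j (mod-sym b _ p∣)
      collision (inj₂ (Fin.suc i)) (inj₁ j)           u≢v p∣ =
        contradiction (mod-sym (a ℤ.* square (Fin.suc i)) _ p∣) (square-≢-a*square j i)
      collision (inj₂ i@(Fin.suc _)) (inj₂ Fin.zero)    u≢v p∣ = a*square≡b i p∣
      collision (inj₂ i@(Fin.suc _)) (inj₂ j@(Fin.suc _)) u≢v p∣ =
        contradiction (a*square-cancel (square i) (square j) p∣) (square-≢ (u≢v ∘ cong inj₂))

      collide : _ → IsSquareMod (a ℤ.* b) p
      collide (i , j , i<j , eq) = collision (Fin.splitAt (suc h) i) (Fin.splitAt (suc h) j)
        (λ eq′ → Fin.<⇒≢ i<j (trans (sym (Fin.join-splitAt (suc h) (suc h) i))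
          (trans (cong (Fin.join (suc h) (suc h)) eq′) (Fin.join-splitAt (suc h) (suc h) j))))
        (%ℕ≡⇒∣- (value (Fin.splitAt (suc h) i)) (value (Fin.splitAt (suc h) j)) p (Fin.fromℕ<-injective _ _ _ _ eq))

    -- Squares prime to `p` are closed under products, a square factor can be divided out, and two
    -- non-squares multiply to a square; these three facts settle the possible combinations.
    legendre-* : ∀ {a b} → ¬ + p ∣ₛ a → ¬ + p ∣ₛ b → legendre (a ℤ.* b) p ≡ legendre a p ℤ.* legendre b p
    legendre-* {a} {b} p∤a p∤b with + p ∣? a | + p ∣? b | + p ∣? a ℤ.* b
    ... | yes p∣a | _       | _        = contradiction (Signed.∣ᵤ⇒∣ p∣a) p∤a
    ... | no _    | yes p∣b | _        = contradiction (Signed.∣ᵤ⇒∣ p∣b) p∤b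
    ... | no _    | no _    | yes p∣ab =
      contradiction (euclid p-prime a b (Signed.∣ᵤ⇒∣ {+ p} {a ℤ.* b} p∣ab)) [ p∤a , p∤b ]′
    ... | no _    | no _    | no _
      with isSquareMod? a p | isSquareMod? b p | isSquareMod? (a ℤ.* b) p
    ...   | yes a-sq    | yes b-sq    | yes _        = refl
    ...   | yes a-sq    | yes b-sq    | no ab-nonsq  = contradiction (square*square a-sq b-sq) ab-nonsq
    ...   | yes a-sq    | no b-nonsq  | yes ab-sq    = contradiction (square*⇒square p∤a a-sq ab-sq) b-nonsq
    ...   | yes a-sq    | no b-nonsq  | no _         = refl
    ...   | no a-nonsq  | yes b-sq    | yes ab-sq    =
      contradiction (square*⇒square p∤b b-sq (subst (λ c → IsSquareMod c p) (ℤ.*-comm a b) ab-sq)) a-nonsq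
    ...   | no a-nonsq  | yes b-sq    | no _         = refl
    ...   | no a-nonsq  | no b-nonsq  | yes _        = refl
    ...   | no a-nonsq  | no b-nonsq  | no ab-nonsq  =
      contradiction (nonsquare*nonsquare p∤a a-nonsq b-nonsq) ab-nonsq

legendre-unit : ∀ {p a} → ¬ + p ∣ₛ a → IsUnit (legendre a p)
legendre-unit {p} {a} p∤a with + p ∣? a
... | yes p∣a = contradiction (Signed.∣ᵤ⇒∣ p∣a) p∤a
... | no  _   with isSquareMod? a p
...   | yes _ = inj₁ refl
...   | no  _ = inj₂ refl

-- From prime moduli to arbitrary `f`

odd-prime : ∀ {p} → Prime p → p ≢ 2 → ∃ λ h → p ≡ suc (h + h)
odd-prime {p} p-prime p≢2 with p ℕ.% 2 in eq | ℕ.m%n<n p 2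
... | 0 | _ = contradiction (prime⇒irreducible p-prime (ℕ.m%n≡0⇒n∣m p 2 eq)) [ (λ ()) , p≢2 ∘ sym ]′
... | 1 | _ = p ℕ./ 2 , trans (ℕ.m≡m%n+[m/n]*n p 2)
  (cong₂ _+_ eq (trans (ℕ.*-comm (p ℕ./ 2) 2) (cong (λ m → p ℕ./ 2 + m) (ℕ.+-identityʳ (p ℕ./ 2)))))
... | suc (suc _) | s≤s (s≤s ())

kroneckerPrime-* : ∀ {p a b} → Prime p → ¬ + p ∣ₛ a → ¬ + p ∣ₛ b →
                   kroneckerPrime (a ℤ.* b) p ≡ kroneckerPrime a p ℤ.* kroneckerPrime b p
kroneckerPrime-* {0}                 p-prime _ _ = contradiction p-prime ¬prime[0]
kroneckerPrime-* {1}                 p-prime _ _ = contradiction p-prime ¬prime[1]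
kroneckerPrime-* {2} {a} {b}         p-prime _ _ = kronecker₂-* a b
kroneckerPrime-* {suc (suc (suc _))} p-prime p∤a p∤b with odd-prime p-prime (λ ())
... | h , p≡1+2h = legendre-* p-prime h p≡1+2h p∤a p∤b

kroneckerPrime-unit : ∀ {p a} → Prime p → ¬ + p ∣ₛ a → IsUnit (kroneckerPrime a p)
kroneckerPrime-unit {0}                 p-prime _   = contradiction p-prime ¬prime[0]
kroneckerPrime-unit {1}                 p-prime _   = contradiction p-prime ¬prime[1]
kroneckerPrime-unit {2} {a}             p-prime 2∤a = kronecker₂-unit a (2∤a ∘ Signed.∣ᵤ⇒∣)
kroneckerPrime-unit {suc (suc (suc _))} p-prime p∤a = legendre-unit p∤a

unit-* : ∀ {x y} → IsUnit x → IsUnit y → IsUnit (x ℤ.* y)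
unit-* (inj₁ refl) (inj₁ refl) = inj₁ refl
unit-* (inj₁ refl) (inj₂ refl) = inj₂ refl
unit-* (inj₂ refl) (inj₁ refl) = inj₂ refl
unit-* (inj₂ refl) (inj₂ refl) = inj₁ refl

primeFactor-∤ : ∀ {f a} .{{_ : NonZero f}} → ℕ.Coprime f ∣ a ∣ →
                ListAll.All (λ p → Prime p × ¬ + p ∣ₛ a) (factors (factorise f))
primeFactor-∤ {f} f⊥a = ListAll.tabulate λ {p} p∈ →
  ListAll.lookup factorsPrime p∈ , λ p∣a → contradiction
    (subst Prime (f⊥a (subst (p ℕ.∣_) (sym isFactorisation) (∈⇒∣product p∈) , Signed.∣⇒∣ᵤ p∣a))
      (ListAll.lookup factorsPrime p∈)) ¬prime[1]
  where open PrimeFactorisation (factorise f) using (isFactorisation; factorsPrime)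

-- The list of prime factors belongs to `f`, so the three symbols are products over the same primes
-- and can be compared prime by prime. The induction runs over an arbitrary list of primes dividing
-- neither `a` nor `b`.
kronecker-* : ∀ {f a b} .{{_ : NonZero f}} → ℕ.Coprime f ∣ a ∣ → ℕ.Coprime f ∣ b ∣ →
              kronecker (a ℤ.* b) f ≡ kronecker a f ℤ.* kronecker b f
kronecker-* {f@(suc _)} {a} {b} f⊥a f⊥b = go (primeFactor-∤ f⊥a) (primeFactor-∤ f⊥b)
  where
  symbol : ℤ → List ℕ → ℤ
  symbol a ps = foldr ℤ._*_ 1ℤ (List.map (kroneckerPrime a) ps)

  go : ∀ {ps} → ListAll.All (λ p → Prime p × ¬ + p ∣ₛ a) ps → ListAll.All (λ p → Prime p × ¬ + p ∣ₛ b) ps →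
       symbol (a ℤ.* b) ps ≡ symbol a ps ℤ.* symbol b ps
  go []                        []              = refl
  go {p ∷ ps} ((p-prime , p∤a) ∷ as) ((_ , p∤b) ∷ bs) =
    trans (cong₂ ℤ._*_ (kroneckerPrime-* p-prime p∤a p∤b) (go as bs))
      (lemma (kroneckerPrime a p) (kroneckerPrime b p) (symbol a ps) (symbol b ps))
    where
    lemma : ∀ a b c d → a ℤ.* b ℤ.* (c ℤ.* d) ≡ a ℤ.* c ℤ.* (b ℤ.* d)
    lemma = solve-∀

kronecker-unit : ∀ {f a} .{{_ : NonZero f}} → ℕ.Coprime f ∣ a ∣ → IsUnit (kronecker a f)
kronecker-unit {f@(suc _)} {a} f⊥a = go (primeFactor-∤ f⊥a)
  where
  go : ∀ {ps} → ListAll.All (λ p → Prime p × ¬ + p ∣ₛ a) ps → IsUnit (foldr ℤ._*_ 1ℤ (List.map (kroneckerPrime a) ps))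
  go []                     = inj₁ refl
  go ((p-prime , p∤a) ∷ as) = unit-* (kroneckerPrime-unit p-prime p∤a) (go as)

-- The characters of 𝒟

congruence-cong : ∀ i a b → a %ℕ 4 ≡ b %ℕ 4 → Congruence i a → Congruence i b
congruence-cong 0F a b eq c = c
congruence-cong 1F a b eq c = subst (λ r → r ≡ 1 ⊎ r ≡ 3) eq c
congruence-cong 2F a b eq c = trans (sym eq) c

-- When `a` and `b` are odd, so is `g`, hence `g² ≡ 1` and `c ≡ a b` modulo 4; both {1} and {1, 3}
-- are closed under multiplication. The finitely many residues are simply enumerated.
congruence-table : ∀ i (a b g c : Fin 4) →
  (+ toℕ a ℤ.* + toℕ b) %ℕ 4 ≡ (+ toℕ g ℤ.* + toℕ g ℤ.* + toℕ c) %ℕ 4 →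
  Congruence i (+ toℕ a) → Congruence i (+ toℕ b) → Congruence i (+ toℕ c)
congruence-table = toWitness {a? = Fin.all? λ i → Fin.all? λ a → Fin.all? λ b → Fin.all? λ g → Fin.all? λ c →
  ((+ toℕ a ℤ.* + toℕ b) %ℕ 4 ℕ.≟ (+ toℕ g ℤ.* + toℕ g ℤ.* + toℕ c) %ℕ 4) →-dec
  congruence? i (+ toℕ a) →-dec congruence? i (+ toℕ b) →-dec congruence? i (+ toℕ c)} tt

congruence-* : ∀ i {a b c} g → a ℤ.* b ≡ g ℤ.* g ℤ.* c → Congruence i a → Congruence i b → Congruence i c
congruence-* i {a} {b} {c} g ab≡g²c a-cong b-cong = congruence-cong i (rep c) c (sym (%ℕ-residue 4 c))
  (congruence-table i (residue 4 a) (residue 4 b) (residue 4 g) (residue 4 c) eq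
    (congruence-cong i a (rep a) (%ℕ-residue 4 a) a-cong) (congruence-cong i b (rep b) (%ℕ-residue 4 b) b-cong))
  where
  rep : ℤ → ℤ
  rep x = + toℕ (residue 4 x)

  eq : (rep a ℤ.* rep b) %ℕ 4 ≡ (rep g ℤ.* rep g ℤ.* rep c) %ℕ 4
  eq = trans (sym (%ℕ-cong-* 4 a b (rep a) (rep b) (%ℕ-residue 4 a) (%ℕ-residue 4 b))) (trans (cong (_%ℕ 4) ab≡g²c)
    (%ℕ-cong-* 4 (g ℤ.* g) c (rep g ℤ.* rep g) (rep c)
      (%ℕ-cong-* 4 g g (rep g) (rep g) (%ℕ-residue 4 g) (%ℕ-residue 4 g)) (%ℕ-residue 4 c)))

coprime-∣ : ∀ {f m n} → ℕ.Coprime f n → m ℕ.∣ n → ℕ.Coprime f m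
coprime-∣ f⊥n m∣n (e∣f , e∣m) = f⊥n (e∣f , ℕ.∣-trans e∣m m∣n)

unit²≡1 : ∀ {x} → IsUnit x → x ℤ.* x ≡ 1ℤ
unit²≡1 (inj₁ refl) = refl
unit²≡1 (inj₂ refl) = refl

-- Being prime to `a b = g² c`, `f` is prime to `g` and to `c`. The symbol of `g` is thus 1 or -1,
-- and that of `g²` is 1.
kronecker-square-quotient : ∀ {f a b c} g .{{_ : NonZero f}} → ℕ.Coprime f ∣ a ∣ → ℕ.Coprime f ∣ b ∣ →
  a ℤ.* b ≡ g ℤ.* g ℤ.* c → kronecker c f ≡ kronecker a f ℤ.* kronecker b f
kronecker-square-quotient {f} {a} {b} {c} g f⊥a f⊥b ab≡g²c = begin
  kronecker c f                                             ≡⟨ ℤ.*-identityˡ _ ⟨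
  1ℤ ℤ.* kronecker c f
    ≡⟨ cong (ℤ._* kronecker c f) (unit²≡1 (kronecker-unit f⊥g)) ⟨
  kronecker g f ℤ.* kronecker g f ℤ.* kronecker c f
    ≡⟨ cong (ℤ._* kronecker c f) (kronecker-* {a = g} {g} f⊥g f⊥g) ⟨
  kronecker (g ℤ.* g) f ℤ.* kronecker c f
    ≡⟨ kronecker-* {a = g ℤ.* g} {c} (f⊥∣g²c (ℕ.m∣m*n ∣ c ∣)) (f⊥∣g²c (ℕ.n∣m*n ∣ g ℤ.* g ∣)) ⟨
  kronecker (g ℤ.* g ℤ.* c) f                               ≡⟨ cong (λ x → kronecker x f) ab≡g²c ⟨
  kronecker (a ℤ.* b) f                                     ≡⟨ kronecker-* {a = a} {b} f⊥a f⊥b ⟩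
  kronecker a f ℤ.* kronecker b f                           ∎
  where
  open ≡-Reasoning

  f⊥∣g²c : ∀ {m} → m ℕ.∣ ∣ g ℤ.* g ∣ * ∣ c ∣ → ℕ.Coprime f m
  f⊥∣g²c = coprime-∣ (subst (ℕ.Coprime f)
    (trans (sym (ℤ.abs-* a b)) (trans (cong ∣_∣ ab≡g²c) (ℤ.abs-* (g ℤ.* g) c))) (coprime-*ʳ f⊥a f⊥b))

  f⊥g : ℕ.Coprime f ∣ g ∣
  f⊥g = f⊥∣g²c (ℕ.∣-trans (subst (∣ g ∣ ℕ.∣_) (sym (ℤ.abs-* g g)) (ℕ.m∣m*n ∣ g ∣)) (ℕ.m∣m*n ∣ c ∣))

sign-unit-* : ∀ {x y} → IsUnit x → IsUnit y → ℤ.sign (x ℤ.* y) ≡ ℤ.sign x Sign.* ℤ.sign y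
sign-unit-* (inj₁ refl) (inj₁ refl) = refl
sign-unit-* (inj₁ refl) (inj₂ refl) = refl
sign-unit-* (inj₂ refl) (inj₁ refl) = refl
sign-unit-* (inj₂ refl) (inj₂ refl) = refl

-- Together with `sign-◃1*≡1` this turns the integer equation defining `𝐃` into the equality of
-- signs used by `Extends`: a unit of ℤ is its own inverse.
◃1*≡1⇒≡sign : ∀ {x} s → IsUnit x → (s ℤ.◃ 1) ℤ.* x ≡ 1ℤ → s ≡ ℤ.sign x
◃1*≡1⇒≡sign Sign.+ (inj₁ refl) _ = refl
◃1*≡1⇒≡sign Sign.- (inj₂ refl) _ = refl
◃1*≡1⇒≡sign Sign.+ (inj₂ refl) ()
◃1*≡1⇒≡sign Sign.- (inj₁ refl) ()

sign-◃1*≡1 : ∀ {x} → IsUnit x → (ℤ.sign x ℤ.◃ 1) ℤ.* x ≡ 1ℤ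
sign-◃1*≡1 (inj₁ refl) = refl
sign-◃1*≡1 (inj₂ refl) = refl

module _ {n : ℕ} (S : Vec ℤ n) (S≢0 : All ℤ.NonZero S) (d : ℕ) (i : Fin 3) where

  private
    s : Subset n → ℤ
    s = sqfSet S S≢0

  𝒟-isSubgroup : IsSubgroup (𝒟 S S≢0 d i)
  𝒟-isSubgroup = record
    { contains-⊥ = 𝒟-⊥ S S≢0 d i
    ; closed     = λ {T} {U} → closed T U
    }
    where
    closed : ∀ T U → 𝒟 S S≢0 d i T → 𝒟 S S≢0 d i U → 𝒟 S S≢0 d i (T ⊕ U)
    closed T U (sT∣d , sT-cong) (sU∣d , sU-cong) =
      let g , eq = sqfSet-⊕ S S≢0 T U in
      squarefree-product-∣ {s T} {s U} {s (T ⊕ U)} {+ d} {g}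
        {{squarefree⇒nonZero {s T} (sqfSet-squarefree S S≢0 T)}}
        (sqfSet-squarefree S S≢0 (T ⊕ U)) sT∣d sU∣d eq ,
      congruence-* i g eq sT-cong sU-cong

  module _ {f : ℕ} .{{_ : NonZero f}} (f⊥d : ℕ.Coprime f d) where

    -- On `𝒟` the symbol is 1 or -1 and its sign determines it. Elsewhere the symbol may be 0, whose
    -- sign is a mere default that `IsCharacter` and `Extends` never inspect.
    χ : Subset n → Sign
    χ T = ℤ.sign (kronecker (s T) f)

    symbol-unit : ∀ {T} → 𝒟 S S≢0 d i T → IsUnit (kronecker (s T) f)
    symbol-unit (sT∣d , _) = kronecker-unit (coprime-∣ f⊥d sT∣d)

    χ-isCharacter : IsCharacter (𝒟 S S≢0 d i) χ
    χ-isCharacter {T} {U} T∈𝒟 U∈𝒟 = let g , eq = sqfSet-⊕ S S≢0 T U in trans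
      (cong ℤ.sign (kronecker-square-quotient {a = s T} {s U} {s (T ⊕ U)} g
        (coprime-∣ f⊥d (proj₁ T∈𝒟)) (coprime-∣ f⊥d (proj₁ U∈𝒟)) eq))
      (sign-unit-* (symbol-unit T∈𝒟) (symbol-unit U∈𝒟))

    count-𝐃-fibre : count (λ θ → 𝐃? S S≢0 d i (f , θ)) (signMaps n) * ∣𝒟∣ S S≢0 d i ≡ 2 ^ n
    count-𝐃-fibre = trans
      (cong (_* ∣𝒟∣ S S≢0 d i) (count-cong (λ θ → 𝐃? S S≢0 d i (f , θ)) (extends? (𝒟? S S≢0 d i) χ)
        (λ {θ} θ∈𝐃 T T∈𝒟 → ◃1*≡1⇒≡sign (eval θ T) (symbol-unit T∈𝒟) (θ∈𝐃 T T∈𝒟))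
        (λ {θ} ext T T∈𝒟 → subst (λ t → (t ℤ.◃ 1) ℤ.* kronecker (s T) f ≡ 1ℤ) (sym (ext T T∈𝒟))
          (sign-◃1*≡1 (symbol-unit T∈𝒟)))
        (signMaps n)))
      (count-extensions (𝒟? S S≢0 d i) 𝒟-isSubgroup χ-isCharacter)

-- Summation over the units

count-cartesianProduct : ∀ {A B : Set} {P : Pred (A × B) 0ℓ} (P? : Decidable P) (xs : List A) (ys : List B) k m →
  ListAll.All (λ x → count (λ y → P? (x , y)) ys * k ≡ m) xs → count P? (cartesianProduct xs ys) * k ≡ length xs * m
count-cartesianProduct P? [] ys k m [] = refl
count-cartesianProduct P? (x ∷ xs) ys k m (px ∷ pxs) = begin
  count P? (map (x ,_) ys List.++ cartesianProduct xs ys) * k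
    ≡⟨ cong (_* k) (count-++ P? (map (x ,_) ys) (cartesianProduct xs ys)) ⟩
  (count P? (map (x ,_) ys) + count P? (cartesianProduct xs ys)) * k
    ≡⟨ ℕ.*-distribʳ-+ k (count P? (map (x ,_) ys)) (count P? (cartesianProduct xs ys)) ⟩
  count P? (map (x ,_) ys) * k + count P? (cartesianProduct xs ys) * k
    ≡⟨ cong₂ _+_ (trans (cong (_* k) (count-map P? (x ,_) ys)) px) (count-cartesianProduct P? xs ys k m pxs) ⟩
  m + length xs * m ∎
  where open ≡-Reasoning

units-nonZero-coprime : ∀ d → ListAll.All (λ f → NonZero f × ℕ.Coprime f d) (units d)
units-nonZero-coprime d = ListAll.zip
  ( ListAll.filter⁺ (λ f → ℕ.coprime? f d) (ListAll.map⁺ (ListAll.universal (λ _ → _) (upTo d)))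
  , ListAll.all-filter (λ f → ℕ.coprime? f d) (map suc (upTo d)))

-- Normalised fractions are images of unnormalised ones, whose equality is cross-multiplication.
-- Denominators are stored less one, so the 0 stands for denominator 1.
/1≡/ : ∀ N M D .{{_ : NonZero D}} → N * D ≡ M → + N / 1 ≡ + M / D
/1≡/ N M D@(suc D-1) eq = fromℚᵘ-cong {mkℚᵘ (+ N) 0} {mkℚᵘ (+ M) D-1}
  (*≡* (trans (sym (ℤ.pos-* N D)) (trans (cong +_ eq) (sym (ℤ.*-identityʳ (+ M))))))

theorem2 : ∀ {n : ℕ} (S : Vec ℤ n) → Unique S → (S≢0 : All ℤ.NonZero S) →
    (d : ℕ) .{{_ : NonZero d}} (i : Fin 3) →
    + ∣𝐃∣ S S≢0 d i / 1
    ≡ (+ (2 ^ n * φ d) / ∣𝒟∣ S S≢0 d i) {{∣𝒟∣-nonZero S S≢0 d i}}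
theorem2 {n} S _ S≢0 d i = /1≡/ (∣𝐃∣ S S≢0 d i) (2 ^ n * φ d) (∣𝒟∣ S S≢0 d i) {{∣𝒟∣-nonZero S S≢0 d i}} (trans
  (count-cartesianProduct (𝐃? S S≢0 d i) (units d) (signMaps n) (∣𝒟∣ S S≢0 d i) (2 ^ n)
    (ListAll.map (λ (f≢0 , f⊥d) → count-𝐃-fibre S S≢0 d i {{f≢0}} f⊥d) (units-nonZero-coprime d)))
  (ℕ.*-comm (φ d) (2 ^ n)))
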